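{- Let $I\subseteq\mathbb{R}$ be an open interval, let $f,g:I\to\mathbb{R}$ be infinitely differentiable, and let $a(x)=f(x)g(x)$. For integers $n,k\ge 0$ and $x\in I$, let $F(n,k,x)$ denote the coefficient of $z^n$ in $[f(x+z)]^k$ and let $G(n,k,x)$ denote the coefficient of $z^n$ in $[g(x+z)]^k$. Then the composita $Y^{\Delta}(n,k,x)$ of the generating function $Y(x,z)=f(x+z)g(x+z)-f(x)g(x)$ is, for all integers $n\ge k\ge 1$ and all $x\in I$, $$Y^{\Delta}(n,k,x)=\sum_{j=0}^{k}\binom{k}{j}\left(\sum_{i=0}^{n}F(i,j,x)\,G(n-i,j,x)\right)[f(x)g(x)]^{k-j}(-1)^{k-j}.$$
   Context: For an infinitely differentiable function $h$, the expression $h(x+z)$ denotes the formal power series $\sum_{n\ge 0}\frac{h^{(n)}(x)}{n!}z^n$ in $z$, and $h(x+z)-h(x)=\sum_{n\ge 1}\frac{h^{(n)}(x)}{n!}z^n$. The composita of the generating function $h(x+z)-h(x)$ is the array $$H^{\Delta}(n,k,x)=\sum_{\substack{\lambda_1+\cdots+\lambda_k=n\\ \lambda_1,\dots,\lambda_k\ge 1}}\frac{h^{(\lambda_1)}(x)}{\lambda_1!}\cdots\frac{h^{(\lambda_k)}(x)}{\lambda_k!},\qquad n\ge k\ge 1,$$ the sum being over all compositions of $n$ into exactly $k$ positive parts; equivalently, $[h(x+z)-h(x)]^k=\sum_{n\ge k}H^{\Delta}(n,k,x)z^n$. In the claim, $Y^{\Delta}$ is this array for $h=a=fg$. The convention is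 that a zeroth power equals $1$ (so $[f(x+z)]^0=[g(x+z)]^0=1$ and $[f(x)g(x)]^0=1$). -}

module Defs where

open import Algebra.Bundles.Raw using (RawSemiring)
import Algebra.Definitions.RawSemiring as RawSemiringDefs
open import Data.Fin using (toℕ)
open import Data.Integer using (+_)
open import Data.List as List using (List; []; _∷_; concatMap; upTo)
open import Data.Nat as ℕ using (ℕ; zero; suc; _∸_; _⊔_; _!)
import Data.Nat.Properties as ℕ
open import Data.Product using (Σ; ∃; ∃-syntax; _×_; _,_; proj₁; proj₂)
open import Data.Rational as ℚ using (ℚ; 0ℚ; 1ℚ; ½)
import Data.Rational.Properties as ℚ
open import Data.Rational.Solver using (module +-*-Solver)
open import Data.Sum using (inj₁; inj₂)
open import Data.Unit using (⊤)
open import Data.Vec as Vec using (Vec; []; _∷_)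
open import Function.Bundles using (Func)
open import Level using (0ℓ)
open import Relation.Binary.Bundles using (Setoid)
open import Relation.Binary.PropositionalEquality
  using (_≡_; refl; sym; trans; cong; cong₂; subst; subst₂)

module Estimates where

  half+half : ∀ ε → ½ ℚ.* ε ℚ.+ ½ ℚ.* ε ≡ ε
  half+half ε = trans (sym (ℚ.*-distribʳ-+ ε ½ ½)) (ℚ.*-identityˡ ε)

  half-pos : ∀ {ε} → 0ℚ ℚ.< ε → 0ℚ ℚ.< ½ ℚ.* ε
  half-pos {ε} p = subst (ℚ._< ½ ℚ.* ε) (ℚ.*-zeroʳ ½) (ℚ.*-monoʳ-<-pos ½ p)

  +-halves : ∀ {a b ε} → a ℚ.< ½ ℚ.* ε → b ℚ.< ½ ℚ.* ε → a ℚ.+ b ℚ.< ε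
  +-halves {a} {b} {ε} p q =
    subst (a ℚ.+ b ℚ.<_) (half+half ε) (ℚ.+-mono-< p q)

  ∣-∣-comm : ∀ a b → ℚ.∣ a ℚ.- b ∣ ≡ ℚ.∣ b ℚ.- a ∣
  ∣-∣-comm a b = trans (sym (ℚ.∣-p∣≡∣p∣ (a ℚ.- b))) (cong ℚ.∣_∣
    (solve 2 (λ a b → :- (a :- b) := b :- a) refl a b))
    where open +-*-Solver

  triangle : ∀ a b c → ℚ.∣ a ℚ.- c ∣ ℚ.≤ ℚ.∣ a ℚ.- b ∣ ℚ.+ ℚ.∣ b ℚ.- c ∣
  triangle a b c = subst (λ t → ℚ.∣ t ∣ ℚ.≤ ℚ.∣ a ℚ.- b ∣ ℚ.+ ℚ.∣ b ℚ.- c ∣)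
    (solve 3 (λ a b c → (a :- b) :+ (b :- c) := a :- c) refl a b c)
    (ℚ.∣p+q∣≤∣p∣+∣q∣ (a ℚ.- b) (b ℚ.- c))
    where open +-*-Solver

  +-close : ∀ a b c d →
            ℚ.∣ (a ℚ.+ b) ℚ.- (c ℚ.+ d) ∣ ℚ.≤ ℚ.∣ a ℚ.- c ∣ ℚ.+ ℚ.∣ b ℚ.- d ∣
  +-close a b c d =
    subst (λ t → ℚ.∣ t ∣ ℚ.≤ ℚ.∣ a ℚ.- c ∣ ℚ.+ ℚ.∣ b ℚ.- d ∣)
    (solve 4 (λ a b c d → (a :- c) :+ (b :- d) := (a :+ b) :- (c :+ d))
      refl a b c d)
    (ℚ.∣p+q∣≤∣p∣+∣q∣ (a ℚ.- c) (b ℚ.- d))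
    where open +-*-Solver

  neg-close : ∀ a b → ℚ.∣ (ℚ.- a) ℚ.- (ℚ.- b) ∣ ≡ ℚ.∣ a ℚ.- b ∣
  neg-close a b = trans (cong ℚ.∣_∣
    (solve 2 (λ a b → (:- a) :- (:- b) := b :- a) refl a b)) (∣-∣-comm b a)
    where open +-*-Solver

  ∣a∣≤∣a-b∣+∣b∣ : ∀ a b → ℚ.∣ a ∣ ℚ.≤ ℚ.∣ a ℚ.- b ∣ ℚ.+ ℚ.∣ b ∣
  ∣a∣≤∣a-b∣+∣b∣ a b = subst (λ t → ℚ.∣ t ∣ ℚ.≤ ℚ.∣ a ℚ.- b ∣ ℚ.+ ℚ.∣ b ∣)
    (solve 2 (λ a b → (a :- b) :+ b := a) refl a b)
    (ℚ.∣p+q∣≤∣p∣+∣q∣ (a ℚ.- b) b)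
    where open +-*-Solver

  ∣a∣-∣b∣≤∣a-b∣ : ∀ a b → ℚ.∣ a ∣ ℚ.- ℚ.∣ b ∣ ℚ.≤ ℚ.∣ a ℚ.- b ∣
  ∣a∣-∣b∣≤∣a-b∣ a b = subst (ℚ.∣ a ∣ ℚ.- ℚ.∣ b ∣ ℚ.≤_)
    (solve 2 (λ u v → (u :+ v) :- v := u) refl (ℚ.∣ a ℚ.- b ∣) (ℚ.∣ b ∣))
    (ℚ.+-monoˡ-≤ (ℚ.- ℚ.∣ b ∣) (∣a∣≤∣a-b∣+∣b∣ a b))
    where open +-*-Solver

  ∣∣-close : ∀ a b → ℚ.∣ ℚ.∣ a ∣ ℚ.- ℚ.∣ b ∣ ∣ ℚ.≤ ℚ.∣ a ℚ.- b ∣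
  ∣∣-close a b with ℚ.∣p∣≡p∨∣p∣≡-p (ℚ.∣ a ∣ ℚ.- ℚ.∣ b ∣)
  ... | inj₁ e = subst (ℚ._≤ ℚ.∣ a ℚ.- b ∣) (sym e) (∣a∣-∣b∣≤∣a-b∣ a b)
  ... | inj₂ e = subst₂ ℚ._≤_
    (sym (trans e
      (solve 2 (λ u v → :- (u :- v) := v :- u) refl (ℚ.∣ a ∣) (ℚ.∣ b ∣))))
    (∣-∣-comm b a) (∣a∣-∣b∣≤∣a-b∣ b a)
    where open +-*-Solver

  _÷⁺_ : ℚ → (b : ℚ) → .{{ℚ.Positive b}} → ℚ
  (a ÷⁺ b) = (ℚ.1/ b) {{ℚ.pos⇒nonZero b}} ℚ.* a

  ÷⁺-pos : ∀ {a} b .{{_ : ℚ.Positive b}} → 0ℚ ℚ.< a → 0ℚ ℚ.< a ÷⁺ b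
  ÷⁺-pos {a} b p =
    subst (ℚ._< a ÷⁺ b) (ℚ.*-zeroʳ b⁻¹)
      (ℚ.*-monoʳ-<-pos b⁻¹ {{ℚ.1/pos⇒pos b}} p)
    where b⁻¹ = (ℚ.1/ b) {{ℚ.pos⇒nonZero b}}

  *-÷⁺ : ∀ a b .{{_ : ℚ.Positive b}} → b ℚ.* (a ÷⁺ b) ≡ a
  *-÷⁺ a b = trans (sym (ℚ.*-assoc b _ a))
    (trans (cong (ℚ._* a) (ℚ.*-inverseʳ b {{ℚ.pos⇒nonZero b}}))
           (ℚ.*-identityˡ a))

  scaled : ∀ {u t ε} b .{{_ : ℚ.Positive b}} → ℚ.∣ u ∣ ℚ.≤ b →
           ℚ.∣ t ∣ ℚ.< ε ÷⁺ b → ℚ.∣ u ℚ.* t ∣ ℚ.< ε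
  scaled {u} {t} {ε} b p q = begin-strict
    ℚ.∣ u ℚ.* t ∣         ≡⟨ ℚ.∣p*q∣≡∣p∣*∣q∣ u t ⟩
    ℚ.∣ u ∣ ℚ.* ℚ.∣ t ∣   ≤⟨ ℚ.*-monoʳ-≤-nonNeg (ℚ.∣ t ∣) {{ℚ.∣-∣-nonNeg t}} p ⟩
    b ℚ.* ℚ.∣ t ∣         <⟨ ℚ.*-monoʳ-<-pos b q ⟩
    b ℚ.* (ε ÷⁺ b)        ≡⟨ *-÷⁺ ε b ⟩
    ε                     ∎
    where open ℚ.≤-Reasoning

  *-close : ∀ {a b c d ε} A D .{{_ : ℚ.Positive A}} .{{_ : ℚ.Positive D}} →
            ℚ.∣ a ∣ ℚ.≤ A → ℚ.∣ d ∣ ℚ.≤ D →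
            ℚ.∣ b ℚ.- d ∣ ℚ.< (½ ℚ.* ε) ÷⁺ A →
            ℚ.∣ a ℚ.- c ∣ ℚ.< (½ ℚ.* ε) ÷⁺ D →
            ℚ.∣ a ℚ.* b ℚ.- c ℚ.* d ∣ ℚ.< ε
  *-close {a} {b} {c} {d} {ε} A D pa pd pbd pac = ℚ.≤-<-trans
    (subst (λ t → ℚ.∣ t ∣ ℚ.≤ ℚ.∣ a ℚ.* (b ℚ.- d) ∣ ℚ.+ ℚ.∣ d ℚ.* (a ℚ.- c) ∣)
      (solve 4 (λ a b c d → a :* (b :- d) :+ d :* (a :- c) := a :* b :- c :* d)
        refl a b c d)
      (ℚ.∣p+q∣≤∣p∣+∣q∣ (a ℚ.* (b ℚ.- d)) (d ℚ.* (a ℚ.- c))))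
    (+-halves (scaled A pa pbd) (scaled D pd pac))
    where open +-*-Solver

open Estimates

-- Reals are Cauchy sequences of rationals.  The modulus is part of the
-- data, so ℝ is complete without any choice principle.  Equality of
-- reals is _≈_ below.
record ℝ : Set where
  constructor mkℝ
  field
    seq    : ℕ → ℚ
    cauchy : ∀ ε → 0ℚ ℚ.< ε →
             ∃[ N ] ∀ m n → N ℕ.≤ m → N ℕ.≤ n → ℚ.∣ seq m ℚ.- seq n ∣ ℚ.< ε

open ℝ public

Eventually : (ℕ → Set) → Set
Eventually P = ∃[ N ] ∀ n → N ℕ.≤ n → P n

infix 4 _≈_ _<_ _≤_

_≈_ : ℝ → ℝ → Set
x ≈ y = ∀ ε → 0ℚ ℚ.< ε → Eventually λ n → ℚ.∣ seq x n ℚ.- seq y n ∣ ℚ.< ε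

_<_ : ℝ → ℝ → Set
x < y = ∃[ ε ] 0ℚ ℚ.< ε × Eventually λ n → seq x n ℚ.+ ε ℚ.≤ seq y n

_≤_ : ℝ → ℝ → Set
x ≤ y = ∀ ε → 0ℚ ℚ.< ε → Eventually λ n → seq x n ℚ.≤ seq y n ℚ.+ ε

eventually-zip : ∀ {P Q R : ℕ → Set} → (∀ n → P n → Q n → R n) →
       Eventually P → Eventually Q → Eventually R
eventually-zip f (M , p) (N , q) = M ⊔ N , λ n l →
  f n (p n (ℕ.≤-trans (ℕ.m≤m⊔n M N) l)) (q n (ℕ.≤-trans (ℕ.m≤n⊔m M N) l))

bounded : (x : ℝ) →
          ∃[ B ] ℚ.Positive B × Eventually λ n → ℚ.∣ seq x n ∣ ℚ.≤ B
bounded x with cauchy x 1ℚ (ℚ.positive⁻¹ 1ℚ)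
... | N , p = 1ℚ ℚ.+ ℚ.∣ seq x N ∣
  , ℚ.positive (ℚ.+-mono-<-≤ (ℚ.positive⁻¹ 1ℚ) (ℚ.0≤∣p∣ (seq x N)))
  , N , λ n l → ℚ.≤-trans (∣a∣≤∣a-b∣+∣b∣ (seq x n) (seq x N))
      (ℚ.+-monoˡ-≤ (ℚ.∣ seq x N ∣) (ℚ.<⇒≤ (p n N l ℕ.≤-refl)))

fromℚ : ℚ → ℝ
fromℚ q = mkℝ (λ _ → q) λ ε 0<ε → 0 , λ _ _ _ _ →
  subst (ℚ._< ε) (cong ℚ.∣_∣ (sym (ℚ.+-inverseʳ q))) 0<ε

0ℝ 1ℝ : ℝ
0ℝ = fromℚ 0ℚ
1ℝ = fromℚ 1ℚ

infixl 6 _+_ _-_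
infixl 7 _*_
infix  8 -_

_+_ : ℝ → ℝ → ℝ
x + y = mkℝ (λ n → seq x n ℚ.+ seq y n) λ ε 0<ε →
  let M , p = cauchy x (½ ℚ.* ε) (half-pos 0<ε)
      N , q = cauchy y (½ ℚ.* ε) (half-pos 0<ε)
  in M ⊔ N , λ m n l k → ℚ.≤-<-trans
       (+-close (seq x m) (seq y m) (seq x n) (seq y n))
       (+-halves
         (p m n (ℕ.≤-trans (ℕ.m≤m⊔n M N) l) (ℕ.≤-trans (ℕ.m≤m⊔n M N) k))
         (q m n (ℕ.≤-trans (ℕ.m≤n⊔m M N) l) (ℕ.≤-trans (ℕ.m≤n⊔m M N) k)))

-_ : ℝ → ℝ
- x = mkℝ (λ n → ℚ.- seq x n) λ ε 0<ε →
  let N , p = cauchy x ε 0<ε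
  in N , λ m n l k →
       subst (ℚ._< ε) (sym (neg-close (seq x m) (seq x n))) (p m n l k)

_-_ : ℝ → ℝ → ℝ
x - y = x + (- y)

_*_ : ℝ → ℝ → ℝ
x * y = mkℝ (λ n → seq x n ℚ.* seq y n) λ ε 0<ε →
  let A , A⁺ , K , a = bounded x
      B , B⁺ , L , b = bounded y
      instance _ = A⁺
               _ = B⁺
      M , p = cauchy x ((½ ℚ.* ε) ÷⁺ B) (÷⁺-pos B (half-pos 0<ε))
      N , q = cauchy y ((½ ℚ.* ε) ÷⁺ A) (÷⁺-pos A (half-pos 0<ε))
      P = (K ⊔ L) ⊔ (M ⊔ N)
      K≤P = ℕ.≤-trans (ℕ.m≤m⊔n K L) (ℕ.m≤m⊔n (K ⊔ L) (M ⊔ N))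
      L≤P = ℕ.≤-trans (ℕ.m≤n⊔m K L) (ℕ.m≤m⊔n (K ⊔ L) (M ⊔ N))
      M≤P = ℕ.≤-trans (ℕ.m≤m⊔n M N) (ℕ.m≤n⊔m (K ⊔ L) (M ⊔ N))
      N≤P = ℕ.≤-trans (ℕ.m≤n⊔m M N) (ℕ.m≤n⊔m (K ⊔ L) (M ⊔ N))
  in P , λ m n l k → *-close A B
       (a m (ℕ.≤-trans K≤P l)) (b n (ℕ.≤-trans L≤P k))
       (q m n (ℕ.≤-trans N≤P l) (ℕ.≤-trans N≤P k))
       (p m n (ℕ.≤-trans M≤P l) (ℕ.≤-trans M≤P k))

∣_∣ : ℝ → ℝ
∣ x ∣ = mkℝ (λ n → ℚ.∣ seq x n ∣) λ ε 0<ε →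
  let N , p = cauchy x ε 0<ε
  in N , λ m n l k →
       ℚ.≤-<-trans (∣∣-close (seq x m) (seq x n)) (p m n l k)

≈-refl : ∀ {x} → x ≈ x
≈-refl {x} ε 0<ε = 0 , λ n _ →
  subst (ℚ._< ε) (cong ℚ.∣_∣ (sym (ℚ.+-inverseʳ (seq x n)))) 0<ε

≈-sym : ∀ {x y} → x ≈ y → y ≈ x
≈-sym {x} {y} x≈y ε 0<ε with x≈y ε 0<ε
... | N , p = N , λ n l → subst (ℚ._< ε) (∣-∣-comm (seq x n) (seq y n)) (p n l)

≈-trans : ∀ {x y z} → x ≈ y → y ≈ z → x ≈ z
≈-trans {x} {y} {z} x≈y y≈z ε 0<ε = eventually-zip
  (λ n p q → ℚ.≤-<-trans (triangle (seq x n) (seq y n) (seq z n)) (+-halves p q))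
  (x≈y (½ ℚ.* ε) (half-pos 0<ε)) (y≈z (½ ℚ.* ε) (half-pos 0<ε))

*-cong : ∀ {x y u v} → x ≈ y → u ≈ v → x * u ≈ y * v
*-cong {x} {y} {u} {v} x≈y u≈v ε 0<ε =
  let A , A⁺ , a = bounded x
      B , B⁺ , b = bounded v
      instance _ = A⁺
               _ = B⁺
  in eventually-zip (λ n (p , q) (r , s) → *-close A B p q s r)
       (eventually-zip (λ _ → _,_) a b)
       (eventually-zip (λ _ → _,_)
         (x≈y ((½ ℚ.* ε) ÷⁺ B) (÷⁺-pos B (half-pos 0<ε)))
         (u≈v ((½ ℚ.* ε) ÷⁺ A) (÷⁺-pos A (half-pos 0<ε))))

ℝ-setoid : Setoid 0ℓ 0ℓ
ℝ-setoid = record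
  { Carrier       = ℝ
  ; _≈_           = _≈_
  ; isEquivalence = record
    { refl  = λ {x} → ≈-refl {x}
    ; sym   = λ {x} {y} → ≈-sym {x} {y}
    ; trans = λ {x} {y} {z} → ≈-trans {x} {y} {z}
    }
  }

ℝ-rawSemiring : RawSemiring 0ℓ 0ℓ
ℝ-rawSemiring = record
  { Carrier = ℝ ; _≈_ = _≈_ ; _+_ = _+_ ; _*_ = _*_ ; 0# = 0ℝ ; 1# = 1ℝ }

-- n · x is the n-fold sum x + ⋯ + x.
open RawSemiringDefs ℝ-rawSemiring public
  using (sum; _^_) renaming (_×_ to infixr 8 _·_)

∑≤ : ℕ → (ℕ → ℝ) → ℝ
∑≤ n t = sum {suc n} (λ i → t (toℕ i))

infix 5 ∑≤
syntax ∑≤ n (λ i → t) = ∑[ i ≤ n ] t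

data Endpoint : Set where
  infinite : Endpoint
  finite   : ℝ → Endpoint

-- An infinite lower endpoint is -∞, an infinite upper endpoint is +∞.
record OpenInterval : Set where
  constructor ⟨_,_⟩
  field
    lower upper : Endpoint

_above_ : ℝ → Endpoint → Set
x above infinite = ⊤
x above finite a = a < x

_below_ : ℝ → Endpoint → Set
x below infinite = ⊤
x below finite b = x < b

_∈_ : ℝ → OpenInterval → Set
x ∈ ⟨ a , b ⟩ = x above a × x below b

Point : OpenInterval → Set
Point I = Σ ℝ (_∈ I)

pointSetoid : OpenInterval → Setoid 0ℓ 0ℓ
pointSetoid I = record
  { Carrier       = Point I
  ; _≈_           = λ x y → proj₁ x ≈ proj₁ y
  ; isEquivalence = record
    { refl  = λ {x} → ≈-refl {proj₁ x}
    ; sym   = λ {x} {y} → ≈-sym {proj₁ x} {proj₁ y}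
    ; trans = λ {x} {y} {z} → ≈-trans {proj₁ x} {proj₁ y} {proj₁ z}
    }
  }

-- Functions I → ℝ; respecting ≈ makes them independent of the chosen
-- Cauchy sequence and of the proof of membership in I.
_→ℝ : OpenInterval → Set
I →ℝ = Func (pointSetoid I) ℝ-setoid

infixl 9 _⟨_⟩

_⟨_⟩ : ∀ {I} → I →ℝ → Point I → ℝ
_⟨_⟩ = Func.to

infixl 7 _*ᶠ_

_*ᶠ_ : ∀ {I} → I →ℝ → I →ℝ → I →ℝ
_*ᶠ_ {I} f g = record
  { to   = λ x → f ⟨ x ⟩ * g ⟨ x ⟩
  ; cong = λ {x} {y} x≈y →
      *-cong {f ⟨ x ⟩} {f ⟨ y ⟩} {g ⟨ x ⟩} {g ⟨ y ⟩}
        (Func.cong f {x} {y} x≈y) (Func.cong g {x} {y} x≈y)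
  }

-- (f y - f x) / (y - x) → d as y → x, with the quotient cleared so that
-- y need not be apart from x.
HasDerivAt : ∀ {I} → I →ℝ → ℝ → Point I → Set
HasDerivAt {I} f d x =
  ∀ ε → 0ℝ < ε → ∃[ δ ] 0ℝ < δ × ((y : Point I) →
    ∣ proj₁ y - proj₁ x ∣ < δ →
    ∣ (f ⟨ y ⟩ - f ⟨ x ⟩) - d * (proj₁ y - proj₁ x) ∣
      ≤ ε * ∣ proj₁ y - proj₁ x ∣)

record Smooth {I : OpenInterval} (f : I →ℝ) : Set where
  field
    deriv      : ℕ → I →ℝ
    deriv-zero : ∀ x → deriv 0 ⟨ x ⟩ ≈ f ⟨ x ⟩
    deriv-suc  : ∀ n x → HasDerivAt (deriv n) (deriv (suc n) ⟨ x ⟩) x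

open Smooth public

-- A power series in z is its sequence of coefficients.
Series : Set
Series = ℕ → ℝ

_⊛_ : Series → Series → Series
(u ⊛ v) n = ∑[ i ≤ n ] (u i * v (n ∸ i))

constant : ℝ → Series
constant c zero    = c
constant c (suc _) = 0ℝ

series-rawSemiring : RawSemiring 0ℓ 0ℓ
series-rawSemiring = record
  { Carrier = Series
  ; _≈_     = λ u v → ∀ n → u n ≈ v n
  ; _+_     = λ u v n → u n + v n
  ; _*_     = _⊛_
  ; 0#      = constant 0ℝ
  ; 1#      = constant 1ℝ
  }

open RawSemiringDefs series-rawSemiring public
  using () renaming (_^_ to infixr 8 _^ˢ_)

-- The coefficients h⁽ⁿ⁾(x) / n! of h(x + z).
taylor : ∀ {I} {h : I →ℝ} → Smooth h → Point I → Series
taylor h∞ x n = deriv h∞ n ⟨ x ⟩ * fromℚ (ℚ._/_ (+ 1) (n !) {{n ℕ.!≢0}})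

powerCoeff : ∀ {I} {h : I →ℝ} → Smooth h → ℕ → ℕ → Point I → ℝ
powerCoeff h∞ n k x = (taylor h∞ x ^ˢ k) n

-- All (λ₁ , … , λₖ) with every λᵢ ≥ 1 and λ₁ + ⋯ + λₖ = n, each listed
-- once: the first part is suc i with i < n.
compositions : ℕ → (k : ℕ) → List (Vec ℕ k)
compositions n       (suc k) =
  concatMap (λ i → List.map (suc i ∷_) (compositions (n ∸ suc i) k)) (upTo n)
compositions zero    zero    = [] ∷ []
compositions (suc _) zero    = []

-- The composita of h(x + z) - h(x).  Only coefficients of index ≥ 1
-- occur, so subtracting the constant term h(x) has no effect.
composita : ∀ {I} {h : I →ℝ} → Smooth h → ℕ → ℕ → Point I → ℝ
composita h∞ n k x = List.foldr _+_ 0ℝ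
  (List.map (λ ls → Vec.foldr′ _*_ 1ℝ (Vec.map (taylor h∞ x) ls))
            (compositions n k))

{-# OPTIONS --safe #-}
-- In ℝ⟦z⟧ the Taylor series of fg is the product u ⊛ v of those of f and g:
-- repeated use of the product rule gives the n-th derivative of fg, and it is
-- the only one because derivatives are unique.  The composita of t = u ⊛ v is
-- the k-th power of t - t₀, which the binomial theorem in the commutative
-- semiring ℝ⟦z⟧ expands as Σⱼ (k C j) (uʲ ⊛ vʲ) (- t₀)ᵏ⁻ʲ.
module Submission where

open import Algebra.Bundles using (CommutativeRing; CommutativeSemiring)
open import Algebra.Bundles.Raw using (RawSemiring)
import Algebra.Definitions.RawMonoid as RawMonoidDefs
import Algebra.Properties.CommutativeMonoid.Mult as CommutativeMonoidMult
import Algebra.Properties.CommutativeSemiring.Binomial as Binomial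
import Algebra.Properties.CommutativeSemiring.Exp as Exp
import Algebra.Properties.Ring as RingProperties
import Algebra.Properties.Semiring.Mult as SemiringMult
import Algebra.Properties.Semiring.Sum as SemiringSum
import Algebra.Solver.Ring.NaturalCoefficients.Default as NaturalCoefficients
import Algebra.Structures.Biased as Biased
open import Data.Fin as Fin using (Fin; toℕ)
import Data.Integer as ℤ
import Data.Integer.Properties as ℤ
open import Data.Integer.Tactic.RingSolver using (solve-∀)
open import Data.List as List using (List; []; _∷_; _++_; concatMap; applyUpTo)
open import Data.List.Properties using (map-++)
open import Data.Nat as ℕ using (ℕ; zero; suc; _∸_; _!)
open import Data.Nat.Combinatorics using (_C_)
import Data.Nat.Properties as ℕ
open import Data.Product using (_,_; ∃-syntax; proj₁; proj₂)
open import Data.Rational as ℚ using (ℚ; 0ℚ; 1ℚ; ½)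
import Data.Rational.Properties as ℚ
open import Data.Rational.Solver using (module +-*-Solver)
open import Data.Rational.Unnormalised as ℚᵘ using (mkℚᵘ; *≡*)
import Data.Rational.Unnormalised.Properties as ℚᵘ
open import Data.Sum using (inj₁; inj₂)
open import Data.Unit using (tt)
open import Data.Vec as Vec using (Vec; []; _∷_)
open import Function.Base using (id; _∘_)
open import Function.Bundles using (Func)
open import Level using (0ℓ)
open import Relation.Binary.Bundles using (Setoid)
open import Relation.Binary.PropositionalEquality as ≡ using (_≡_)
import Relation.Binary.Reasoning.Setoid as SetoidReasoning
open import Relation.Binary.Structures using (IsEquivalence)
open import Defs using (compositions)

-- Formal power series

-- The closed Leibniz formula with its binomial coefficients is never stated. Dividing the n-th term
-- of a sequence by n! turns the shift of the sequence into the formal derivative `∂`, which obeys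
-- the product rule for `⊛`; so the n-th derivative of a product and n! times the n-th coefficient
-- of the product series satisfy the same recursion. `Smooth` carries a chosen sequence of
-- derivatives and the claim covers every choice for fg, which is why the derivatives built by the
-- product rule have to be compared with the given ones. Openness of the interval enters there: it
-- provides a second point at a positive rational distance. The algebra is done over an arbitrary
-- commutative ring, whose equality is opaque. Over ℝ, `_≈_` unfolds to a statement about sequences
-- from which unification cannot recover the two reals; hence the many implicit arguments written
-- out in the later parts.

module PowerSeries {c ℓ} (R : CommutativeRing c ℓ) where

  open CommutativeRing R
  open SemiringSum semiring using (sum; sum-cong-≋; *-distribˡ-sum)
  open SemiringMult semiring using (_×_; ×-congʳ; ×-assocˡ; ×-assoc-*; ×-comm-*)
  open CommutativeMonoidMult +-commutativeMonoid using (×-distrib-+)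
  open Exp commutativeSemiring using (_^_; ^-congˡ; ^-distrib-*)
  open SetoidReasoning setoid
  open NaturalCoefficients commutativeSemiring using (solve; _:=_; _:+_; _:*_; con)

  Series : Set c
  Series = ℕ → Carrier

  infix 4 _≋_
  _≋_ : Series → Series → Set ℓ
  u ≋ v = ∀ n → u n ≈ v n

  tail : Series → Series
  tail u n = u (suc n)

  constant : Carrier → Series
  constant a zero    = a
  constant a (suc _) = 0#

  infixl 6 _⊕_
  _⊕_ : Series → Series → Series
  (u ⊕ v) n = u n + v n

  infixl 7 _⊛_
  _⊛_ : Series → Series → Series
  (u ⊛ v) n = sum {suc n} (λ i → u (toℕ i) * v (n ∸ toℕ i))

  ⊛-cong : ∀ {u u′ v v′} → u ≋ u′ → v ≋ v′ → u ⊛ v ≋ u′ ⊛ v′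
  ⊛-cong u≋u′ v≋v′ n = sum-cong-≋ {suc n} λ i → *-cong (u≋u′ (toℕ i)) (v≋v′ (n ∸ toℕ i))

  -- tail (u ⊛ v) = u₀ · tail v + tail u ⊛ v holds by computation and is the induction
  -- step of the laws below.
  ⊛-distribʳ-⊕ : ∀ w u v → (u ⊕ v) ⊛ w ≋ (u ⊛ w) ⊕ (v ⊛ w)
  ⊛-distribʳ-⊕ w u v zero    =
    solve 3 (λ u v w → (u :+ v) :* w :+ con 0 := (u :* w :+ con 0) :+ (v :* w :+ con 0))
      refl (u 0) (v 0) (w 0)
  ⊛-distribʳ-⊕ w u v (suc n) = trans
    (+-congˡ (⊛-distribʳ-⊕ w (tail u) (tail v) n))
    (solve 5 (λ u v w a b → (u :+ v) :* w :+ (a :+ b) := (u :* w :+ a) :+ (v :* w :+ b))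
      refl (u 0) (v 0) (w (suc n)) ((tail u ⊛ w) n) ((tail v ⊛ w) n))

  scale-⊛ : ∀ a u v n → ((λ i → a * u i) ⊛ v) n ≈ a * (u ⊛ v) n
  scale-⊛ a u v n = trans
    (sum-cong-≋ {suc n} λ i → *-assoc a (u (toℕ i)) (v (n ∸ toℕ i)))
    (sym (*-distribˡ-sum {suc n} a (λ i → u (toℕ i) * v (n ∸ toℕ i))))

  zero-⊛ : ∀ u n → ((λ _ → 0#) ⊛ u) n ≈ 0#
  zero-⊛ u zero    = trans (+-identityʳ _) (zeroˡ (u 0))
  zero-⊛ u (suc n) = trans (+-cong (zeroˡ (u (suc n))) (zero-⊛ u n)) (+-identityˡ 0#)

  constant-⊛ : ∀ a u n → (constant a ⊛ u) n ≈ a * u n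
  constant-⊛ a u zero    = +-identityʳ _
  constant-⊛ a u (suc n) = trans (+-congˡ (zero-⊛ u n)) (+-identityʳ _)

  ⊛-assoc : ∀ u v w → (u ⊛ v) ⊛ w ≋ u ⊛ (v ⊛ w)
  ⊛-assoc u v w zero    =
    solve 3 (λ u v w → (u :* v :+ con 0) :* w :+ con 0 := u :* (v :* w :+ con 0) :+ con 0)
      refl (u 0) (v 0) (w 0)
  ⊛-assoc u v w (suc n) = begin
    (u 0 * v 0 + 0#) * w (suc n) + (((λ i → u 0 * tail v i) ⊕ (tail u ⊛ v)) ⊛ w) n
      ≈⟨ +-congˡ (⊛-distribʳ-⊕ w (λ i → u 0 * tail v i) (tail u ⊛ v) n) ⟩
    (u 0 * v 0 + 0#) * w (suc n) + (((λ i → u 0 * tail v i) ⊛ w) n + ((tail u ⊛ v) ⊛ w) n)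
      ≈⟨ +-congˡ (+-cong (scale-⊛ (u 0) (tail v) w n) (⊛-assoc (tail u) v w n)) ⟩
    (u 0 * v 0 + 0#) * w (suc n) + (u 0 * (tail v ⊛ w) n + (tail u ⊛ (v ⊛ w)) n)
      ≈⟨ solve 5 (λ u v w a b → (u :* v :+ con 0) :* w :+ (u :* a :+ b)
                              := u :* (v :* w :+ a) :+ b)
           refl (u 0) (v 0) (w (suc n)) ((tail v ⊛ w) n) ((tail u ⊛ (v ⊛ w)) n) ⟩
    u 0 * (v ⊛ w) (suc n) + (tail u ⊛ (v ⊛ w)) n ∎

  -- Peeling off u₀, commuting, and peeling off v₀ leaves the product of the two tails at an index
  -- smaller by two, hence the two base cases. Once the tails are commuted, the same moves are made
  -- backwards.
  ⊛-comm : ∀ u v → u ⊛ v ≋ v ⊛ u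
  ⊛-comm u v zero          = +-congʳ (*-comm (u 0) (v 0))
  ⊛-comm u v (suc zero)    =
    solve 4 (λ u₀ u₁ v₀ v₁ → u₀ :* v₁ :+ (u₁ :* v₀ :+ con 0)
                           := v₀ :* u₁ :+ (v₁ :* u₀ :+ con 0))
      refl (u 0) (u 1) (v 0) (v 1)
  ⊛-comm u v (suc (suc n)) = begin
    u 0 * v (suc (suc n)) + (tail u ⊛ v) (suc n)
      ≈⟨ +-congˡ (⊛-comm (tail u) v (suc n)) ⟩
    u 0 * v (suc (suc n)) + (v 0 * u (suc (suc n)) + (tail v ⊛ tail u) n)
      ≈⟨ +-congˡ (+-congˡ (⊛-comm (tail v) (tail u) n)) ⟩
    u 0 * v (suc (suc n)) + (v 0 * u (suc (suc n)) + (tail u ⊛ tail v) n)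
      ≈⟨ solve 5 (λ u₀ uₙ v₀ vₙ a → u₀ :* vₙ :+ (v₀ :* uₙ :+ a) := v₀ :* uₙ :+ (u₀ :* vₙ :+ a))
           refl (u 0) (u (suc (suc n))) (v 0) (v (suc (suc n))) ((tail u ⊛ tail v) n) ⟩
    v 0 * u (suc (suc n)) + (u ⊛ tail v) (suc n)
      ≈⟨ +-congˡ (⊛-comm u (tail v) (suc n)) ⟩
    v 0 * u (suc (suc n)) + (tail v ⊛ u) (suc n) ∎

  series-commutativeSemiring : CommutativeSemiring c ℓ
  series-commutativeSemiring = record
    { Carrier = Series
    ; _≈_     = _≋_
    ; _+_     = _⊕_
    ; _*_     = _⊛_
    ; 0#      = λ _ → 0#
    ; 1#      = constant 1#
    ; isCommutativeSemiring = isCommutativeSemiringˡ record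
      { +-isCommutativeMonoid = record
        { isMonoid = record
          { isSemigroup = record
            { isMagma = record
              { isEquivalence = ≋-isEquivalence
              ; ∙-cong        = λ p q n → +-cong (p n) (q n)
              }
            ; assoc = λ u v w n → +-assoc (u n) (v n) (w n)
            }
          ; identity = (λ u n → +-identityˡ (u n)) , (λ u n → +-identityʳ (u n))
          }
        ; comm = λ u v n → +-comm (u n) (v n)
        }
      ; *-isCommutativeMonoid = isCommutativeMonoidˡ record
        { isSemigroup = record
          { isMagma = record { isEquivalence = ≋-isEquivalence ; ∙-cong = ⊛-cong }
          ; assoc   = ⊛-assoc
          }
        ; identityˡ = λ u n → trans (constant-⊛ 1# u n) (*-identityˡ (u n))
        ; comm      = ⊛-comm
        }
      ; distribʳ = ⊛-distribʳ-⊕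
      ; zeroˡ    = zero-⊛
      }
    }
    where
    open Biased _≋_ using (isCommutativeMonoidˡ; isCommutativeSemiringˡ)

    ≋-isEquivalence : IsEquivalence _≋_
    ≋-isEquivalence = record
      { refl  = λ n → refl
      ; sym   = λ p n → sym (p n)
      ; trans = λ p q n → trans (p n) (q n)
      }

  module 𝕊 where
    open CommutativeSemiring series-commutativeSemiring using () renaming (semiring to 𝕊-semiring)
    open SemiringSum 𝕊-semiring public using (sum)
    open Exp series-commutativeSemiring public using (_^_; ^-congˡ; ^-distrib-*)
    open SemiringMult 𝕊-semiring public using (_×_)
    open Binomial series-commutativeSemiring public using (theorem)

  -- The formal derivative and exponential generating functions

  ∂ : Series → Series
  ∂ u n = suc n × u (suc n)

  -- Write u = u₀ + z · `tail u` and use ∂(z w) = w + z ∂w. The term w for w = `tail u ⊛ v` is the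
  -- extra copy `p`; it merges with `∂ (tail u) ⊛ v` into the shifted `∂ u ⊛ v`.
  ∂-leibniz : ∀ u v → ∂ (u ⊛ v) ≋ (∂ u ⊛ v) ⊕ (u ⊛ ∂ v)
  ∂-leibniz u v zero    =
    solve 4 (λ u₀ u₁ v₀ v₁ → (u₀ :* v₁ :+ (u₁ :* v₀ :+ con 0)) :+ con 0
                           := ((u₁ :+ con 0) :* v₀ :+ con 0) :+ (u₀ :* (v₁ :+ con 0) :+ con 0))
      refl (u 0) (u 1) (v 0) (v 1)
  ∂-leibniz u v (suc n) = begin
    suc (suc n) × (u 0 * v₂ + (tail u ⊛ v) (suc n))
      ≈⟨ ×-distrib-+ (u 0 * v₂) ((tail u ⊛ v) (suc n)) (suc (suc n)) ⟩
    suc (suc n) × (u 0 * v₂) + (p + ∂ (tail u ⊛ v) n)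
      ≈⟨ +-cong (sym (×-comm-* (suc (suc n)) (u 0) v₂)) (+-congˡ (∂-leibniz (tail u) v n)) ⟩
    u 0 * ∂ v (suc n) + (p + ((∂ (tail u) ⊛ v) n + (tail u ⊛ ∂ v) n))
      ≈⟨ solve 6 (λ a u₁ v₁ q r s → a :+ ((u₁ :* v₁ :+ q) :+ (r :+ s))
                               := (u₁ :* v₁ :+ (q :+ r)) :+ (a :+ s))
           refl (u 0 * ∂ v (suc n)) (u 1) (v (suc n)) ((tail (tail u) ⊛ v) n)
           ((∂ (tail u) ⊛ v) n) ((tail u ⊛ ∂ v) n) ⟩
    (u 1 * v (suc n) + ((tail (tail u) ⊛ v) n + (∂ (tail u) ⊛ v) n)) + (u ⊛ ∂ v) (suc n)
      ≈⟨ +-congʳ (+-cong (*-congʳ (sym (+-identityʳ (u 1))))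
           (sym (⊛-distribʳ-⊕ v (tail (tail u)) (∂ (tail u)) n))) ⟩
    (∂ u ⊛ v) (suc n) + (u ⊛ ∂ v) (suc n) ∎
    where
    v₂ = v (suc (suc n))
    p  = (tail u ⊛ v) (suc n)

  -- The n-th derivative of u₀ v₀ when tail u and tail v list the derivatives of u₀ and v₀.
  leibniz : ℕ → Series → Series → Carrier
  leibniz zero    u v = u 0 * v 0
  leibniz (suc n) u v = leibniz n (tail u) v + leibniz n u (tail v)

  module Exponential (r : ℕ → Carrier) (!-inverse : ∀ n → (n !) × r n ≈ 1#) where

    egf : Series → Series
    egf u n = u n * r n

    -- This rests on 1/n! = (n+1)/(n+1)!. `r-suc` derives it from the inverses alone: insert (n+1)!
    -- r(n+1) = 1, then cancel n! r(n) = 1.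
    ∂-egf : ∀ u → egf (tail u) ≋ ∂ (egf u)
    ∂-egf u n = begin
      u (suc n) * r n                  ≈⟨ *-congˡ r-suc ⟩
      u (suc n) * (suc n × r (suc n))  ≈⟨ ×-comm-* (suc n) (u (suc n)) _ ⟩
      suc n × (u (suc n) * r (suc n))  ∎
      where
      r-suc : r n ≈ suc n × r (suc n)
      r-suc = begin
        r n                                    ≈⟨ *-identityʳ _ ⟨
        r n * 1#                               ≈⟨ *-congˡ (!-inverse (suc n)) ⟨
        r n * (((suc n) ℕ.* n !) × r (suc n))  ≡⟨ ≡.cong (λ m → r n * (m × r (suc n))) (ℕ.*-comm (suc n) (n !)) ⟩
        r n * ((n ! ℕ.* suc n) × r (suc n))    ≈⟨ *-congˡ (×-assocˡ _ (n !) (suc n)) ⟨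
        r n * ((n !) × (suc n × r (suc n)))    ≈⟨ ×-comm-* (n !) _ _ ⟩
        (n !) × (r n * (suc n × r (suc n)))    ≈⟨ ×-assoc-* (n !) _ _ ⟨
        ((n !) × r n) * (suc n × r (suc n))    ≈⟨ *-congʳ (!-inverse n) ⟩
        1# * (suc n × r (suc n))               ≈⟨ *-identityˡ _ ⟩
        suc n × r (suc n)                      ∎

    -- The right side is the constant term of the n-th formal derivative. By `∂-egf` and
    -- `∂-leibniz`, one `∂` of the product of two such series shifts either one sequence or the
    -- other, which is the recursion of `leibniz`.
    leibniz-! : ∀ n u v → leibniz n u v ≈ (n !) × (egf u ⊛ egf v) n
    leibniz-! zero    u v = begin
      u 0 * v 0                  ≈⟨ *-cong (r-zero (u 0)) (r-zero (v 0)) ⟩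
      (u 0 * r 0) * (v 0 * r 0)  ≈⟨ +-identityʳ _ ⟨
      (egf u ⊛ egf v) 0          ≈⟨ +-identityʳ _ ⟨
      1 × (egf u ⊛ egf v) 0      ∎
      where
      r-zero : ∀ a → a ≈ a * r 0
      r-zero a = sym (trans (*-congˡ (trans (sym (+-identityʳ _)) (!-inverse 0))) (*-identityʳ a))
    leibniz-! (suc n) u v = begin
      leibniz n (tail u) v + leibniz n u (tail v)
        ≈⟨ +-cong (leibniz-! n (tail u) v) (leibniz-! n u (tail v)) ⟩
      (n !) × (egf (tail u) ⊛ egf v) n + (n !) × (egf u ⊛ egf (tail v)) n
        ≈⟨ ×-distrib-+ _ _ (n !) ⟨
      (n !) × ((egf (tail u) ⊛ egf v) n + (egf u ⊛ egf (tail v)) n)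
        ≈⟨ ×-congʳ (n !) (+-cong
             (⊛-cong {v = egf v} (∂-egf u) (λ _ → refl) n)
             (⊛-cong {u = egf u} (λ _ → refl) (∂-egf v) n)) ⟩
      (n !) × ((∂ (egf u) ⊛ egf v) n + (egf u ⊛ ∂ (egf v)) n)
        ≈⟨ ×-congʳ (n !) (∂-leibniz (egf u) (egf v) n) ⟨
      (n !) × (suc n × (egf u ⊛ egf v) (suc n))
        ≈⟨ ×-assocˡ _ (n !) (suc n) ⟩
      (n ! ℕ.* suc n) × (egf u ⊛ egf v) (suc n)
        ≡⟨ ≡.cong (_× (egf u ⊛ egf v) (suc n)) (ℕ.*-comm (n !) (suc n)) ⟩
      ((suc n) !) × (egf u ⊛ egf v) (suc n) ∎

    leibniz-egf : ∀ n u v → leibniz n u v * r n ≈ (egf u ⊛ egf v) n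
    leibniz-egf n u v = begin
      leibniz n u v * r n                ≈⟨ *-congʳ (leibniz-! n u v) ⟩
      ((n !) × (egf u ⊛ egf v) n) * r n  ≈⟨ ×-assoc-* (n !) _ _ ⟩
      (n !) × ((egf u ⊛ egf v) n * r n)  ≈⟨ ×-comm-* (n !) _ _ ⟨
      (egf u ⊛ egf v) n * ((n !) × r n)  ≈⟨ *-congˡ (!-inverse n) ⟩
      (egf u ⊛ egf v) n * 1#             ≈⟨ *-identityʳ _ ⟩
      (egf u ⊛ egf v) n                  ∎

    egf-product : ∀ {t u v} f g → u ≋ egf f → v ≋ egf g →
                  (∀ n → t n ≈ leibniz n f g * r n) → t ≋ u ⊛ v
    egf-product f g u≋f v≋g t≈ n = trans (t≈ n)
      (trans (leibniz-egf n f g) (sym (⊛-cong u≋f v≋g n)))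

  -- Sums over compositions and powers of a series

  ∑ˡ : List Carrier → Carrier
  ∑ˡ = List.foldr _+_ 0#

  ∑ˡ-++ : ∀ xs ys → ∑ˡ (xs ++ ys) ≈ ∑ˡ xs + ∑ˡ ys
  ∑ˡ-++ []       ys = sym (+-identityˡ _)
  ∑ˡ-++ (x ∷ xs) ys = trans (+-congˡ (∑ˡ-++ xs ys)) (sym (+-assoc x _ _))

  -- `upTo n` is `applyUpTo id n`; a general `f` lets the induction pass to `f ∘ suc`.
  ∑ˡ-concatMap : ∀ {a} {A : Set a} (w : A → Carrier) (F : ℕ → List A) (f : ℕ → ℕ) n →
                 ∑ˡ (List.map w (concatMap F (applyUpTo f n)))
                   ≈ sum {n} (λ i → ∑ˡ (List.map w (F (f (toℕ i)))))
  ∑ˡ-concatMap w F f zero    = refl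
  ∑ˡ-concatMap w F f (suc n) = begin
    ∑ˡ (List.map w (F (f 0) ++ concatMap F (applyUpTo (f ∘ suc) n)))
      ≡⟨ ≡.cong ∑ˡ (map-++ w (F (f 0)) _) ⟩
    ∑ˡ (List.map w (F (f 0)) ++ List.map w (concatMap F (applyUpTo (f ∘ suc) n)))
      ≈⟨ ∑ˡ-++ (List.map w (F (f 0))) _ ⟩
    ∑ˡ (List.map w (F (f 0))) + ∑ˡ (List.map w (concatMap F (applyUpTo (f ∘ suc) n)))
      ≈⟨ +-congˡ (∑ˡ-concatMap w F (f ∘ suc) n) ⟩
    sum {suc n} (λ i → ∑ˡ (List.map w (F (f (toℕ i))))) ∎

  weight : ∀ {k} → Series → Vec ℕ k → Carrier
  weight u ls = Vec.foldr′ _*_ 1# (Vec.map u ls)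

  compositionSum : Series → ℕ → ℕ → Carrier
  compositionSum u n k = ∑ˡ (List.map (weight u) (compositions n k))

  ∑ˡ-weight-∷ : ∀ {k} u i (lss : List (Vec ℕ k)) →
                ∑ˡ (List.map (weight u) (List.map (i ∷_) lss)) ≈ u i * ∑ˡ (List.map (weight u) lss)
  ∑ˡ-weight-∷ u i []         = sym (zeroʳ (u i))
  ∑ˡ-weight-∷ u i (ls ∷ lss) = trans (+-congˡ (∑ˡ-weight-∷ u i lss)) (sym (distribˡ (u i) _ _))

  withoutConstantTerm : Series → Series
  withoutConstantTerm u zero    = 0#
  withoutConstantTerm u (suc n) = u (suc n)

  -- The first part of a composition is the index taken from the first factor; the remaining parts
  -- form a composition for the other factors.
  compositionSum-^ : ∀ u n k → compositionSum u n k ≈ (withoutConstantTerm u 𝕊.^ k) n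
  compositionSum-^ u zero    zero    = +-identityʳ 1#
  compositionSum-^ u (suc n) zero    = refl
  compositionSum-^ u n       (suc k) = begin
    compositionSum u n (suc k)
      ≈⟨ ∑ˡ-concatMap (weight u) (λ i → List.map (suc i ∷_) (compositions (n ∸ suc i) k)) id n ⟩
    sum {n} (λ i → ∑ˡ (List.map (weight u)
      (List.map (suc (toℕ i) ∷_) (compositions (n ∸ suc (toℕ i)) k))))
      ≈⟨ sum-cong-≋ {n} (λ i → trans
           (∑ˡ-weight-∷ u (suc (toℕ i)) (compositions (n ∸ suc (toℕ i)) k))
           (*-congˡ (compositionSum-^ u (n ∸ suc (toℕ i)) k))) ⟩
    sum {n} (λ i → u (suc (toℕ i)) * (withoutConstantTerm u 𝕊.^ k) (n ∸ suc (toℕ i)))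
      -- Parts start at 1 but a convolution starts at index 0; the inserted zero is the term of the
      -- vanishing constant coefficient.
      ≈⟨ +-identityˡ _ ⟨
    0# + sum {n} (λ i → u (suc (toℕ i)) * (withoutConstantTerm u 𝕊.^ k) (n ∸ suc (toℕ i)))
      ≈⟨ +-congʳ (zeroˡ _) ⟨
    (withoutConstantTerm u 𝕊.^ suc k) n ∎

  sum-eval : ∀ {m} (t : Fin m → Series) n → 𝕊.sum t n ≡ sum (λ i → t i n)
  sum-eval {zero}  t n = ≡.refl
  sum-eval {suc m} t n = ≡.cong (t Fin.zero n +_) (sum-eval (t ∘ Fin.suc) n)

  ×-eval : ∀ m u n → (m 𝕊.× u) n ≡ m × u n
  ×-eval zero    u n = ≡.refl
  ×-eval (suc m) u n = ≡.cong (u n +_) (×-eval m u n)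

  constant-^ : ∀ a m → constant a 𝕊.^ m ≋ constant (a ^ m)
  constant-^ a zero    n = refl
  constant-^ a (suc m) n = trans (constant-⊛ a (constant a 𝕊.^ m) n)
    (trans (*-congˡ (constant-^ a m n)) (lemma n))
    where
    lemma : ∀ n → a * constant (a ^ m) n ≈ constant (a * a ^ m) n
    lemma zero    = refl
    lemma (suc n) = zeroʳ a

  -- Subtracting the constant term is adding `constant (- a)`, which brings it into the form of the
  -- semiring binomial theorem; powers of a constant series are constant, so convolving with them
  -- only scales. Keeping `a` apart from `t 0` lets it be f(x)g(x) itself instead of a Taylor
  -- coefficient.
  compositionSum-⊛ : ∀ {t u v a} → t ≋ u ⊛ v → t 0 ≈ a → ∀ n k →
    compositionSum t n k ≈ sum {suc k} (λ j → (k C toℕ j) ×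
      ((u 𝕊.^ toℕ j ⊛ v 𝕊.^ toℕ j) n * a ^ (k ∸ toℕ j) * (- 1#) ^ (k ∸ toℕ j)))
  compositionSum-⊛ {t} {u} {v} {a} t≋uv t₀≈a n k = begin
    compositionSum t n k
      ≈⟨ compositionSum-^ t n k ⟩
    (withoutConstantTerm t 𝕊.^ k) n
      ≈⟨ 𝕊.^-congˡ k shift n ⟩
    (((u ⊛ v) ⊕ constant (- a)) 𝕊.^ k) n
      ≈⟨ 𝕊.theorem k (u ⊛ v) (constant (- a)) n ⟩
    𝕊.sum {suc k} (λ j → (k C toℕ j) 𝕊.× product (toℕ j) (k ∸ toℕ j)) n
      ≡⟨ sum-eval {suc k} (λ j → (k C toℕ j) 𝕊.× product (toℕ j) (k ∸ toℕ j)) n ⟩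
    sum {suc k} (λ j → ((k C toℕ j) 𝕊.× product (toℕ j) (k ∸ toℕ j)) n)
      ≈⟨ sum-cong-≋ {suc k} (λ j → trans
           (reflexive (×-eval (k C toℕ j) (product (toℕ j) (k ∸ toℕ j)) n))
           (×-congʳ (k C toℕ j) (product≈ (toℕ j) (k ∸ toℕ j)))) ⟩
    sum {suc k} (λ j → (k C toℕ j) ×
      ((u 𝕊.^ toℕ j ⊛ v 𝕊.^ toℕ j) n * a ^ (k ∸ toℕ j) * (- 1#) ^ (k ∸ toℕ j))) ∎
    where
    open RingProperties ring using (-1*x≈-x)

    shift : withoutConstantTerm t ≋ (u ⊛ v) ⊕ constant (- a)
    shift zero    = sym (trans (+-congʳ (trans (sym (t≋uv 0)) t₀≈a)) (-‿inverseʳ a))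
    shift (suc i) = trans (t≋uv (suc i)) (sym (+-identityʳ _))

    negate-^ : ∀ m → (- a) ^ m ≈ a ^ m * (- 1#) ^ m
    negate-^ m = trans
      (^-congˡ m (trans (sym (-1*x≈-x a)) (*-comm (- 1#) a)))
      (^-distrib-* a (- 1#) m)

    product : ℕ → ℕ → Series
    product j m = (u ⊛ v) 𝕊.^ j ⊛ constant (- a) 𝕊.^ m

    product≈ : ∀ j m → product j m n
                       ≈ (u 𝕊.^ j ⊛ v 𝕊.^ j) n * a ^ m * (- 1#) ^ m
    product≈ j m = begin
      product j m n
        ≈⟨ ⊛-cong (𝕊.^-distrib-* u v j) (constant-^ (- a) m) n ⟩
      ((u 𝕊.^ j ⊛ v 𝕊.^ j) ⊛ constant ((- a) ^ m)) n
        ≈⟨ ⊛-comm (u 𝕊.^ j ⊛ v 𝕊.^ j) (constant ((- a) ^ m)) n ⟩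
      (constant ((- a) ^ m) ⊛ (u 𝕊.^ j ⊛ v 𝕊.^ j)) n
        ≈⟨ constant-⊛ ((- a) ^ m) (u 𝕊.^ j ⊛ v 𝕊.^ j) n ⟩
      (- a) ^ m * (u 𝕊.^ j ⊛ v 𝕊.^ j) n
        ≈⟨ *-comm _ _ ⟩
      (u 𝕊.^ j ⊛ v 𝕊.^ j) n * (- a) ^ m
        ≈⟨ *-congˡ (negate-^ m) ⟩
      (u 𝕊.^ j ⊛ v 𝕊.^ j) n * (a ^ m * (- 1#) ^ m)
        ≈⟨ *-assoc _ _ _ ⟨
      (u 𝕊.^ j ⊛ v 𝕊.^ j) n * a ^ m * (- 1#) ^ m ∎

  -- The operations ⋆ and ∑, and the arbitrary x, y, q, z in compositionSum-∑, keep every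
  -- equation between real numbers one operation deep: definitional equality of larger
  -- terms would compare the Cauchy moduli, which is infeasible.
  module Transfer
    {_⋆_ : Carrier → Carrier → Carrier} (⋆≈* : ∀ a b → a ⋆ b ≈ a * b)
    {∑ : ℕ → Series → Carrier} (∑≈sum : ∀ n t → ∑ n t ≈ sum {suc n} (t ∘ toℕ))
    where

    ∑-⊛ : ∀ {u u′ v v′} → u ≋ u′ → v ≋ v′ → ∀ n → ∑ n (λ i → u i ⋆ v (n ∸ i)) ≈ (u′ ⊛ v′) n
    ∑-⊛ {u} {u′} {v} {v′} u≋u′ v≋v′ n = trans (∑≈sum n (λ i → u i ⋆ v (n ∸ i)))
      (sum-cong-≋ {suc n} λ i → trans
        (⋆≈* (u (toℕ i)) (v (n ∸ toℕ i)))
        (*-cong (u≋u′ (toℕ i)) (v≋v′ (n ∸ toℕ i))))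

    -- The recursion determines the powers, so powers formed with another presentation of the
    -- product and of the sum agree with `𝕊.^`.
    power-unique : ∀ {u} (P : ℕ → Series) → P 0 ≋ constant 1# →
                   (∀ k n → P (suc k) n ≈ ∑ n (λ i → u i ⋆ P k (n ∸ i))) →
                   ∀ k → P k ≋ u 𝕊.^ k
    power-unique P P-zero P-suc zero      = P-zero
    power-unique P P-zero P-suc (suc k) n = trans (P-suc k n)
      (∑-⊛ (λ _ → refl) (power-unique P P-zero P-suc k) n)

    compositionSum-∑ : ∀ {t u v a b n k w} (U V : ℕ → Series) (s : ℕ → Carrier) →
      w ≈ compositionSum t n k → b ≈ - 1# →
      t ≋ u ⊛ v → t 0 ≈ a → (∀ j → U j ≋ u 𝕊.^ j) → (∀ j → V j ≋ v 𝕊.^ j) →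
      (∀ j x y q z → x ≈ a ^ (k ∸ j) → y ≈ b ^ (k ∸ j) →
        q ≈ ∑ n (λ i → U j i ⋆ V j (n ∸ i)) * x → z ≈ q * y → s j ≈ (k C j) × z) →
      w ≈ ∑ k s
    compositionSum-∑ {t} {u} {v} {a} {b} {n} {k} {w} U V s w≈ b≈-1 t≋uv t₀≈a U≋u^ V≋v^ s≈ = begin
      w
        ≈⟨ w≈ ⟩
      compositionSum t n k
        ≈⟨ compositionSum-⊛ t≋uv t₀≈a n k ⟩
      sum {suc k} (λ j → (k C toℕ j) ×
        ((u 𝕊.^ toℕ j ⊛ v 𝕊.^ toℕ j) n * a ^ (k ∸ toℕ j) * (- 1#) ^ (k ∸ toℕ j)))
        ≈⟨ sum-cong-≋ {suc k} (λ j → summand (toℕ j)) ⟨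
      sum {suc k} (s ∘ toℕ)
        ≈⟨ ∑≈sum k s ⟨
      ∑ k s ∎
      where
      summand : ∀ j → s j ≈ (k C j) ×
        ((u 𝕊.^ j ⊛ v 𝕊.^ j) n * a ^ (k ∸ j) * (- 1#) ^ (k ∸ j))
      -- The blanks are the two powers with exponent k - j, of a and of -1, and the two partial
      -- products of the summand.
      summand j = s≈ j _ _ _ _ refl (^-congˡ (k ∸ j) (sym b≈-1))
        (*-congʳ (sym (∑-⊛ (U≋u^ j) (V≋v^ j) n))) refl

open import Data.Integer using (+_)
open import Data.Product using (_×_)
open import Defs
open Estimates

-- The ring of real numbers

-- The operations of ℝ act termwise, so this carries every polynomial identity over from ℚ.
seq-≡⇒≈ : ∀ {x y} → (∀ n → seq x n ≡ seq y n) → x ≈ y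
seq-≡⇒≈ {x} {y} x≡y ε 0<ε = 0 , λ n _ →
  ≡.subst (λ q → ℚ.∣ seq x n ℚ.- q ∣ ℚ.< ε) (x≡y n) (≈-refl {x} ε 0<ε .proj₂ n ℕ.z≤n)

+-cong : ∀ {x y u v} → x ≈ y → u ≈ v → x + u ≈ y + v
+-cong {x} {y} {u} {v} x≈y u≈v ε 0<ε = eventually-zip
  (λ n p q → ℚ.≤-<-trans (+-close (seq x n) (seq u n) (seq y n) (seq v n)) (+-halves p q))
  (x≈y (½ ℚ.* ε) (half-pos 0<ε)) (u≈v (½ ℚ.* ε) (half-pos 0<ε))

-‿cong : ∀ {x y} → x ≈ y → - x ≈ - y
-‿cong {x} {y} x≈y ε 0<ε with x≈y ε 0<ε
... | N , p = N , λ n l → ≡.subst (ℚ._< ε) (≡.sym (neg-close (seq x n) (seq y n))) (p n l)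

ℝ-commutativeRing : CommutativeRing 0ℓ 0ℓ
ℝ-commutativeRing = record
  { Carrier = ℝ
  ; _≈_     = _≈_
  ; _+_     = _+_
  ; _*_     = _*_
  ; -_      = -_
  ; 0#      = 0ℝ
  ; 1#      = 1ℝ
  ; isCommutativeRing = record
    { isRing = record
      { +-isAbelianGroup = record
        { isGroup = record
          { isMonoid = record
            { isSemigroup = record
              { isMagma = record
                { isEquivalence = Setoid.isEquivalence ℝ-setoid
                ; ∙-cong        = λ {x} {y} {u} {v} → +-cong {x} {y} {u} {v}
                }
              ; assoc = λ x y z → termwise {x + y + z} {x + (y + z)}
                  λ n → ℚ.+-assoc (seq x n) (seq y n) (seq z n)
              }
            ; identity = (λ x → termwise {0ℝ + x} {x} λ n → ℚ.+-identityˡ (seq x n))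
                       , (λ x → termwise {x + 0ℝ} {x} λ n → ℚ.+-identityʳ (seq x n))
            }
          ; inverse = (λ x → termwise { - x + x} {0ℝ} λ n → ℚ.+-inverseˡ (seq x n))
                    , (λ x → termwise {x + - x} {0ℝ} λ n → ℚ.+-inverseʳ (seq x n))
          ; ⁻¹-cong = λ {x} {y} → -‿cong {x} {y}
          }
        ; comm = λ x y → termwise {x + y} {y + x} λ n → ℚ.+-comm (seq x n) (seq y n)
        }
      ; *-cong     = λ {x} {y} {u} {v} → *-cong {x} {y} {u} {v}
      ; *-assoc    = λ x y z → termwise {x * y * z} {x * (y * z)}
          λ n → ℚ.*-assoc (seq x n) (seq y n) (seq z n)
      ; *-identity = (λ x → termwise {1ℝ * x} {x} λ n → ℚ.*-identityˡ (seq x n))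
                   , (λ x → termwise {x * 1ℝ} {x} λ n → ℚ.*-identityʳ (seq x n))
      ; distrib    = (λ x y z → termwise {x * (y + z)} {x * y + x * z}
                         λ n → ℚ.*-distribˡ-+ (seq x n) (seq y n) (seq z n))
                   , (λ x y z → termwise {(y + z) * x} {y * x + z * x}
                         λ n → ℚ.*-distribʳ-+ (seq x n) (seq y n) (seq z n))
      }
    ; *-comm = λ x y → termwise {x * y} {y * x} λ n → ℚ.*-comm (seq x n) (seq y n)
    }
  }
  where
  termwise = λ {x} {y} → seq-≡⇒≈ {x} {y}

-- For m = n! this is the hypothesis on `r` in `Exponential`.
·-fromℚ-1/ : ∀ m .{{_ : ℕ.NonZero m}} → m · fromℚ (+ 1 ℚ./ m) ≈ 1ℝ
·-fromℚ-1/ m@(suc _) = seq-≡⇒≈ {m · fromℚ (+ 1 ℚ./ m)} {1ℝ} λ n →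
  ≡.trans (multiple m n) (ℚ.fromℚᵘ-cong {mkℚᵘ (+ m) _} {ℚᵘ.1ℚᵘ} (*≡* (ℤ.*-comm (+ m) (+ 1))))
  where
  open ℚᵘ.≃-Reasoning

  -- `ℚ./` reduces to lowest terms, which is stuck for a variable numerator; unnormalised fractions
  -- can be added by cross-multiplication.
  add : ∀ k → (+ 1 ℚ./ m) ℚ.+ (+ k ℚ./ m) ≡ + (suc k) ℚ./ m
  add k = ℚ.toℚᵘ-injective (begin
    ℚ.toℚᵘ ((+ 1 ℚ./ m) ℚ.+ (+ k ℚ./ m))
      ≈⟨ ℚ.toℚᵘ-homo-+ (+ 1 ℚ./ m) (+ k ℚ./ m) ⟩
    ℚ.toℚᵘ (+ 1 ℚ./ m) ℚᵘ.+ ℚ.toℚᵘ (+ k ℚ./ m)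
      ≈⟨ ℚᵘ.+-cong (ℚ.toℚᵘ-fromℚᵘ (mkℚᵘ (+ 1) _)) (ℚ.toℚᵘ-fromℚᵘ (mkℚᵘ (+ k) _)) ⟩
    (+ 1 ℚᵘ./ m) ℚᵘ.+ (+ k ℚᵘ./ m)
      ≈⟨ *≡* (commonDenominator (+ 1) (+ k) (+ m)) ⟩
    + (suc k) ℚᵘ./ m
      ≈⟨ ℚ.toℚᵘ-fromℚᵘ (mkℚᵘ (+ suc k) _) ⟨
    ℚ.toℚᵘ (+ (suc k) ℚ./ m) ∎)
    where
    commonDenominator : ∀ a b c → (a ℤ.* c ℤ.+ b ℤ.* c) ℤ.* c ≡ (a ℤ.+ b) ℤ.* (c ℤ.* c)
    commonDenominator = solve-∀

  multiple : ∀ k n → seq (k · fromℚ (+ 1 ℚ./ m)) n ≡ + k ℚ./ m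
  multiple zero    n = ≡.sym (ℚ.0/n≡0 m)
  multiple (suc k) n = ≡.trans (≡.cong ((+ 1 ℚ./ m) ℚ.+_) (multiple k n)) (add k)

-- Differentiation

-- The estimate u = O(h) with an explicit rational constant, h being the displacement y - x. As a
-- record it does not unfold, so `c` and `h` stay inferable. The bound on reals allows an arbitrary
-- slack η at each index, which the lemmas below halve or divide as they need.
record Dominated (c : ℚ) (h u : ℝ) : Set where
  constructor dominated
  field
    bound : ∣ u ∣ ≤ fromℚ c * ∣ h ∣

EventuallyBounded : ℚ → ℝ → Set
EventuallyBounded B u = Eventually λ n → ℚ.∣ seq u n ∣ ℚ.≤ B

dominated-refl : ∀ h → Dominated 1ℚ h h
dominated-refl h = dominated λ η 0<η → 0 , λ n _ → ≡.subst (λ q → ℚ.∣ seq h n ∣ ℚ.≤ q ℚ.+ η)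
  (≡.sym (ℚ.*-identityˡ ℚ.∣ seq h n ∣))
  (ℚ.≤-trans (ℚ.≤-reflexive (≡.sym (ℚ.+-identityʳ _))) (ℚ.+-monoʳ-≤ ℚ.∣ seq h n ∣ (ℚ.<⇒≤ 0<η)))

dominated-cong : ∀ {c h} u v → u ≈ v → Dominated c h u → Dominated c h v
dominated-cong {c} {h} u v u≈v (dominated p) = dominated λ η 0<η → eventually-zip
  (λ n v-u<½η u≤ → begin
    ℚ.∣ seq v n ∣
      ≤⟨ ∣a∣≤∣a-b∣+∣b∣ (seq v n) (seq u n) ⟩
    ℚ.∣ seq v n ℚ.- seq u n ∣ ℚ.+ ℚ.∣ seq u n ∣
      ≤⟨ ℚ.+-mono-≤ (ℚ.<⇒≤ v-u<½η) u≤ ⟩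
    ½ ℚ.* η ℚ.+ (c ℚ.* ℚ.∣ seq h n ∣ ℚ.+ ½ ℚ.* η)
      ≡⟨ solve 2 (λ a b → b :+ (a :+ b) := a :+ (b :+ b)) ≡.refl (c ℚ.* ℚ.∣ seq h n ∣) (½ ℚ.* η) ⟩
    c ℚ.* ℚ.∣ seq h n ∣ ℚ.+ (½ ℚ.* η ℚ.+ ½ ℚ.* η)
      ≡⟨ ≡.cong (c ℚ.* ℚ.∣ seq h n ∣ ℚ.+_) (half+half η) ⟩
    c ℚ.* ℚ.∣ seq h n ∣ ℚ.+ η ∎)
  (≈-sym {u} {v} u≈v (½ ℚ.* η) (half-pos 0<η)) (p (½ ℚ.* η) (half-pos 0<η))
  where
  open ℚ.≤-Reasoning
  open +-*-Solver

dominated-+ : ∀ {c d h} u v → Dominated c h u → Dominated d h v → Dominated (c ℚ.+ d) h (u + v)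
dominated-+ {c} {d} {h} u v (dominated p) (dominated q) = dominated λ η 0<η → eventually-zip
  (λ n u≤ v≤ → begin
    ℚ.∣ seq u n ℚ.+ seq v n ∣
      ≤⟨ ℚ.∣p+q∣≤∣p∣+∣q∣ (seq u n) (seq v n) ⟩
    ℚ.∣ seq u n ∣ ℚ.+ ℚ.∣ seq v n ∣
      ≤⟨ ℚ.+-mono-≤ u≤ v≤ ⟩
    (c ℚ.* ℚ.∣ seq h n ∣ ℚ.+ ½ ℚ.* η) ℚ.+ (d ℚ.* ℚ.∣ seq h n ∣ ℚ.+ ½ ℚ.* η)
      ≡⟨ solve 4 (λ c d h e → (c :* h :+ e) :+ (d :* h :+ e) := (c :+ d) :* h :+ (e :+ e))
           ≡.refl c d ℚ.∣ seq h n ∣ (½ ℚ.* η) ⟩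
    (c ℚ.+ d) ℚ.* ℚ.∣ seq h n ∣ ℚ.+ (½ ℚ.* η ℚ.+ ½ ℚ.* η)
      ≡⟨ ≡.cong ((c ℚ.+ d) ℚ.* ℚ.∣ seq h n ∣ ℚ.+_) (half+half η) ⟩
    (c ℚ.+ d) ℚ.* ℚ.∣ seq h n ∣ ℚ.+ η ∎)
  (p (½ ℚ.* η) (half-pos 0<η)) (q (½ ℚ.* η) (half-pos 0<η))
  where
  open ℚ.≤-Reasoning
  open +-*-Solver

dominated-* : ∀ {B c h} .{{_ : ℚ.Positive B}} w u →
              EventuallyBounded B w → Dominated c h u → Dominated (B ℚ.* c) h (w * u)
dominated-* {B} {c} {h} w u w≤B (dominated p) = dominated λ η 0<η → eventually-zip
  (λ n w≤ u≤ → begin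
    ℚ.∣ seq w n ℚ.* seq u n ∣
      ≡⟨ ℚ.∣p*q∣≡∣p∣*∣q∣ (seq w n) (seq u n) ⟩
    ℚ.∣ seq w n ∣ ℚ.* ℚ.∣ seq u n ∣
      ≤⟨ ℚ.*-monoʳ-≤-nonNeg ℚ.∣ seq u n ∣ {{ℚ.∣-∣-nonNeg (seq u n)}} w≤ ⟩
    B ℚ.* ℚ.∣ seq u n ∣
      ≤⟨ ℚ.*-monoˡ-≤-nonNeg B {{ℚ.pos⇒nonNeg B}} u≤ ⟩
    B ℚ.* (c ℚ.* ℚ.∣ seq h n ∣ ℚ.+ η ÷⁺ B)
      ≡⟨ solve 4 (λ B c h e → B :* (c :* h :+ e) := B :* c :* h :+ B :* e)
           ≡.refl B c ℚ.∣ seq h n ∣ (η ÷⁺ B) ⟩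
    B ℚ.* c ℚ.* ℚ.∣ seq h n ∣ ℚ.+ B ℚ.* (η ÷⁺ B)
      ≡⟨ ≡.cong (B ℚ.* c ℚ.* ℚ.∣ seq h n ∣ ℚ.+_) (*-÷⁺ η B) ⟩
    B ℚ.* c ℚ.* ℚ.∣ seq h n ∣ ℚ.+ η ∎)
  w≤B (p (η ÷⁺ B) (÷⁺-pos B 0<η))
  where
  open ℚ.≤-Reasoning
  open +-*-Solver

-- Taking the slack equal to δ costs one more multiple of δ, hence K + 1.
dominated⇒bounded : ∀ {K δ h u} .{{_ : ℚ.Positive K}} → 0ℚ ℚ.< δ →
                    Dominated K h u → EventuallyBounded δ h → EventuallyBounded ((K ℚ.+ 1ℚ) ℚ.* δ) u
dominated⇒bounded {K} {δ} {h} {u} 0<δ (dominated p) h≤δ = eventually-zip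
  (λ n u≤ h≤ → begin
    ℚ.∣ seq u n ∣                ≤⟨ u≤ ⟩
    K ℚ.* ℚ.∣ seq h n ∣ ℚ.+ δ   ≤⟨ ℚ.+-monoˡ-≤ δ (ℚ.*-monoˡ-≤-nonNeg K {{ℚ.pos⇒nonNeg K}} h≤) ⟩
    K ℚ.* δ ℚ.+ δ               ≡⟨ solve 2 (λ K δ → K :* δ :+ δ := (K :+ con 1ℚ) :* δ) ≡.refl K δ ⟩
    (K ℚ.+ 1ℚ) ℚ.* δ            ∎)
  (p δ 0<δ) h≤δ
  where
  open ℚ.≤-Reasoning
  open +-*-Solver

dominated-mono : ∀ {c d h u} → c ℚ.≤ d → Dominated c h u → Dominated d h u
dominated-mono {c} {d} {h} c≤d (dominated p) = dominated λ η 0<η → p η 0<η .proj₁ , λ n l →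
  ℚ.≤-trans (p η 0<η .proj₂ n l)
    (ℚ.+-monoˡ-≤ η (ℚ.*-monoʳ-≤-nonNeg ℚ.∣ seq h n ∣ {{ℚ.∣-∣-nonNeg (seq h n)}} c≤d))

⊓-pos : ∀ p q → 0ℚ ℚ.< p → 0ℚ ℚ.< q → 0ℚ ℚ.< p ℚ.⊓ q
⊓-pos p q 0<p 0<q with ℚ.⊓-sel p q
... | inj₁ e = ≡.subst (0ℚ ℚ.<_) (≡.sym e) 0<p
... | inj₂ e = ≡.subst (0ℚ ℚ.<_) (≡.sym e) 0<q

-- Of the gap e between x and b, at most half is used for the move; the other half witnesses that
-- the new point is still below b.
below-shift : ∀ x b δ → x below b → 0ℚ ℚ.< δ →
              ∃[ η ] 0ℚ ℚ.< η × η ℚ.≤ δ × (x + fromℚ η) below b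
below-shift x infinite   δ _             0<δ = δ , 0<δ , ℚ.≤-refl , tt
below-shift x (finite b) δ (e , 0<e , N , x+e≤b) 0<δ =
  δ ℚ.⊓ (½ ℚ.* e) , ⊓-pos δ (½ ℚ.* e) 0<δ (half-pos 0<e) , ℚ.p⊓q≤p δ (½ ℚ.* e)
  , ½ ℚ.* e , half-pos 0<e , N , λ n l → begin
      seq x n ℚ.+ δ ℚ.⊓ (½ ℚ.* e) ℚ.+ ½ ℚ.* e
        ≤⟨ ℚ.+-monoˡ-≤ (½ ℚ.* e) (ℚ.+-monoʳ-≤ (seq x n) (ℚ.p⊓q≤q δ (½ ℚ.* e))) ⟩
      seq x n ℚ.+ ½ ℚ.* e ℚ.+ ½ ℚ.* e
        ≡⟨ ≡.trans (ℚ.+-assoc (seq x n) _ _) (≡.cong (seq x n ℚ.+_) (half+half e)) ⟩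
      seq x n ℚ.+ e
        ≤⟨ x+e≤b n l ⟩
      seq b n ∎
  where open ℚ.≤-Reasoning

above-shift : ∀ x a η → x above a → 0ℚ ℚ.< η → (x + fromℚ η) above a
above-shift x infinite   η _                     _   = tt
above-shift x (finite a) η (e , 0<e , N , a+e≤x) 0<η = e , 0<e , N , λ n l →
  ℚ.≤-trans (a+e≤x n l) (ℚ.≤-trans (ℚ.≤-reflexive (≡.sym (ℚ.+-identityʳ (seq x n))))
    (ℚ.+-monoʳ-≤ (seq x n) (ℚ.<⇒≤ 0<η)))

module _ {I : OpenInterval} where

  Near : ℚ → Point I → Point I → Set
  Near δ x y = EventuallyBounded δ (proj₁ y - proj₁ x)

  near-mono : ∀ {δ δ′} x y → δ ℚ.≤ δ′ → Near δ x y → Near δ′ x y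
  near-mono x y δ≤δ′ (N , p) = N , λ n l → ℚ.≤-trans (p n l) δ≤δ′

  remainder : I →ℝ → ℝ → Point I → Point I → ℝ
  remainder f d x y = (f ⟨ y ⟩ - f ⟨ x ⟩) - d * (proj₁ y - proj₁ x)

  -- With rational ε and δ, minima and quotients are taken in ℚ and every estimate is made index by
  -- index.
  HasDerivAtℚ : I →ℝ → ℝ → Point I → Set
  HasDerivAtℚ f d x = ∀ ε → 0ℚ ℚ.< ε → ∃[ δ ] 0ℚ ℚ.< δ × (∀ y → Near δ x y →
    Dominated ε (proj₁ y - proj₁ x) (remainder f d x y))

  toRational : ∀ f d x → HasDerivAt f d x → HasDerivAtℚ f d x
  toRational f d x f′ ε 0<ε =
    let δ , (δ′ , 0<δ′ , δ′≤δ) , p = f′ (fromℚ ε) (ε , 0<ε , 0 , λ _ _ → ℚ.≤-reflexive (ℚ.+-identityˡ ε))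
    -- `δ′` is the gap witnessing 0 < δ. Half of it bounds the distance; the other half is the gap
    -- demanded by the strict inequality between reals.
    in ½ ℚ.* δ′ , half-pos 0<δ′ , λ y near → dominated (p y (½ ℚ.* δ′ , half-pos 0<δ′ , eventually-zip
         (λ n h≤ δ′≤ → ℚ.≤-trans (ℚ.+-monoˡ-≤ (½ ℚ.* δ′) h≤)
           (ℚ.≤-trans (ℚ.≤-reflexive (≡.trans (half+half δ′) (≡.sym (ℚ.+-identityˡ δ′)))) δ′≤))
         near δ′≤δ))

  fromRational : ∀ f d x → HasDerivAtℚ f d x → HasDerivAt f d x
  fromRational f d x f′ ε (ε′ , 0<ε′ , ε′≤ε) =
    let δ , 0<δ , p = f′ ε′ 0<ε′
    in fromℚ δ
     , (δ , 0<δ , 0 , λ _ _ → ℚ.≤-reflexive (ℚ.+-identityˡ δ))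
     , λ y (e , 0<e , N , h+e≤δ) η 0<η → eventually-zip
        (λ n r≤ ε′≤ → ℚ.≤-trans r≤ (ℚ.+-monoˡ-≤ η
          (ℚ.*-monoʳ-≤-nonNeg ℚ.∣ h y n ∣ {{ℚ.∣-∣-nonNeg (h y n)}}
            (ℚ.≤-trans (ℚ.≤-reflexive (≡.sym (ℚ.+-identityˡ ε′))) ε′≤))))
        (Dominated.bound (p y (N , λ n l → ℚ.≤-trans
          (ℚ.≤-trans (ℚ.≤-reflexive (≡.sym (ℚ.+-identityʳ ℚ.∣ h y n ∣)))
            (ℚ.+-monoʳ-≤ ℚ.∣ h y n ∣ (ℚ.<⇒≤ 0<e)))
          (h+e≤δ n l))) η 0<η)
        ε′≤ε
    where
    h : Point I → ℕ → ℚ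
    h y = seq (proj₁ y - proj₁ x)

  infixl 6 _+ᶠ_
  _+ᶠ_ : I →ℝ → I →ℝ → I →ℝ
  f +ᶠ g = record
    { to   = λ x → f ⟨ x ⟩ + g ⟨ x ⟩
    ; cong = λ {x} {y} x≈y → +-cong {f ⟨ x ⟩} {f ⟨ y ⟩} {g ⟨ x ⟩} {g ⟨ y ⟩}
        (Func.cong f {x} {y} x≈y) (Func.cong g {x} {y} x≈y)
    }

  hasDerivAt-cong : ∀ (f g : I →ℝ) d x → (∀ y → f ⟨ y ⟩ ≈ g ⟨ y ⟩) → HasDerivAt f d x → HasDerivAt g d x
  hasDerivAt-cong f g d x f≈g f′ = fromRational g d x λ ε 0<ε →
    let δ , 0<δ , p = toRational f d x f′ ε 0<ε
    in δ , 0<δ , λ y near → dominated-cong (remainder f d x y) (remainder g d x y)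
         (+-cong {f ⟨ y ⟩ - f ⟨ x ⟩} {g ⟨ y ⟩ - g ⟨ x ⟩}
                 { - (d * (proj₁ y - proj₁ x))} { - (d * (proj₁ y - proj₁ x))}
           (+-cong {f ⟨ y ⟩} {g ⟨ y ⟩} { - f ⟨ x ⟩} { - g ⟨ x ⟩}
             (f≈g y) (-‿cong {f ⟨ x ⟩} {g ⟨ x ⟩} (f≈g x)))
           (≈-refl { - (d * (proj₁ y - proj₁ x))}))
         (p y near)

  hasDerivAt-+ : ∀ (f g : I →ℝ) d e x → HasDerivAt f d x → HasDerivAt g e x → HasDerivAt (f +ᶠ g) (d + e) x
  hasDerivAt-+ f g d e x f′ g′ = fromRational (f +ᶠ g) (d + e) x λ ε 0<ε →
    let δ₁ , 0<δ₁ , p = toRational f d x f′ (½ ℚ.* ε) (half-pos 0<ε)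
        δ₂ , 0<δ₂ , q = toRational g e x g′ (½ ℚ.* ε) (half-pos 0<ε)
    in δ₁ ℚ.⊓ δ₂ , ⊓-pos δ₁ δ₂ 0<δ₁ 0<δ₂ , λ y near →
       dominated-mono (ℚ.≤-reflexive (half+half ε))
         (dominated-cong
           (remainder f d x y + remainder g e x y) (remainder (f +ᶠ g) (d + e) x y)
           (seq-≡⇒≈ {remainder f d x y + remainder g e x y} {remainder (f +ᶠ g) (d + e) x y}
             λ n → rearrange (seq (f ⟨ y ⟩) n) (seq (f ⟨ x ⟩) n) (seq (g ⟨ y ⟩) n) (seq (g ⟨ x ⟩) n)
                     (seq d n) (seq e n) (seq (proj₁ y) n ℚ.- seq (proj₁ x) n))
           (dominated-+ (remainder f d x y) (remainder g e x y)
             (p y (near-mono x y (ℚ.p⊓q≤p δ₁ δ₂) near))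
             (q y (near-mono x y (ℚ.p⊓q≤q δ₁ δ₂) near))))
    where
    open +-*-Solver
    rearrange : ∀ fy fx gy gx d e h →
                ((fy ℚ.- fx) ℚ.- d ℚ.* h) ℚ.+ ((gy ℚ.- gx) ℚ.- e ℚ.* h)
                  ≡ ((fy ℚ.+ gy) ℚ.- (fx ℚ.+ gx)) ℚ.- (d ℚ.+ e) ℚ.* h
    rearrange = solve 7 (λ fy fx gy gx d e h →
      ((fy :- fx) :- d :* h) :+ ((gy :- gx) :- e :* h)
        := ((fy :+ gy) :- (fx :+ gx)) :- (d :+ e) :* h) ≡.refl

  increment : I →ℝ → Point I → Point I → ℝ
  increment f x y = f ⟨ y ⟩ - f ⟨ x ⟩

  -- Use ε = 1: the increment is the remainder plus d (y - x), and B bounds |d|.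
  locallyLipschitz : ∀ (f : I →ℝ) d x → HasDerivAt f d x → ∃[ K ] ℚ.Positive K × ∃[ δ ] 0ℚ ℚ.< δ ×
    (∀ y → Near δ x y → Dominated K (proj₁ y - proj₁ x) (increment f x y))
  locallyLipschitz f d x f′ =
    let B , B⁺ , d≤B = bounded d
        instance _ = B⁺
        δ , 0<δ , p = toRational f d x f′ 1ℚ (ℚ.positive⁻¹ 1ℚ)
    in 1ℚ ℚ.+ B ℚ.* 1ℚ
     , ℚ.pos+pos⇒pos 1ℚ (B ℚ.* 1ℚ) {{ℚ.pos*pos⇒pos B 1ℚ}}
     , δ , 0<δ , λ y near → dominated-cong
         (remainder f d x y + d * (proj₁ y - proj₁ x)) (increment f x y)
         (seq-≡⇒≈ {remainder f d x y + d * (proj₁ y - proj₁ x)} {increment f x y}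
           λ n → cancel (seq (f ⟨ y ⟩) n ℚ.- seq (f ⟨ x ⟩) n)
                        (seq d n ℚ.* (seq (proj₁ y) n ℚ.- seq (proj₁ x) n)))
         (dominated-+ (remainder f d x y) (d * (proj₁ y - proj₁ x)) (p y near)
           (dominated-* d (proj₁ y - proj₁ x) d≤B (dominated-refl (proj₁ y - proj₁ x))))
    where
    open +-*-Solver
    cancel : ∀ a b → (a ℚ.- b) ℚ.+ b ≡ a
    cancel = solve 2 (λ a b → (a :- b) :+ b := a) ≡.refl

  -- The remainder of fg is g(x) times that of f, plus f(x) times that of g, plus the product of the
  -- two increments. The first two terms get ε/4 each; the last, of second order in y - x, gets ε/2.
  hasDerivAt-* : ∀ (f g : I →ℝ) d e x → HasDerivAt f d x → HasDerivAt g e x →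
                 HasDerivAt (f *ᶠ g) (d * g ⟨ x ⟩ + f ⟨ x ⟩ * e) x
  hasDerivAt-* f g d e x f′ g′ = fromRational (f *ᶠ g) (d * g ⟨ x ⟩ + f ⟨ x ⟩ * e) x λ ε 0<ε →
    let A , A⁺ , f≤A = bounded (f ⟨ x ⟩)
        B , B⁺ , g≤B = bounded (g ⟨ x ⟩)
        K , K⁺ , δ₁ , 0<δ₁ , p = locallyLipschitz f d x f′
        L , L⁺ , δ₂ , 0<δ₂ , q = locallyLipschitz g e x g′
        instance _ = A⁺
                 _ = B⁺
                 _ = K⁺
                 _ = L⁺
                 _ = ℚ.pos+pos⇒pos L 1ℚ
                 _ = ℚ.pos*pos⇒pos (L ℚ.+ 1ℚ) K
        0<¼ε = half-pos (half-pos 0<ε)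
        δ₃ , 0<δ₃ , r = toRational f d x f′ ((½ ℚ.* (½ ℚ.* ε)) ÷⁺ B) (÷⁺-pos B 0<¼ε)
        δ₄ , 0<δ₄ , s = toRational g e x g′ ((½ ℚ.* (½ ℚ.* ε)) ÷⁺ A) (÷⁺-pos A 0<¼ε)
        -- Within δ₅ the increment of g is at most (L + 1) δ₅ and that of f is dominated by K |y -
        -- x|, so their product is dominated by (ε/2) |y - x|.
        δ₅   = (½ ℚ.* ε) ÷⁺ ((L ℚ.+ 1ℚ) ℚ.* K)
        0<δ₅ = ÷⁺-pos ((L ℚ.+ 1ℚ) ℚ.* K) (half-pos 0<ε)
        instance _ = ℚ.pos*pos⇒pos (L ℚ.+ 1ℚ) δ₅ {{ℚ.positive 0<δ₅}}
        δ = δ₁ ℚ.⊓ (δ₂ ℚ.⊓ (δ₃ ℚ.⊓ (δ₄ ℚ.⊓ δ₅)))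
        δ≤₂ = ℚ.≤-trans (ℚ.p⊓q≤q δ₁ _) (ℚ.p⊓q≤p δ₂ (δ₃ ℚ.⊓ (δ₄ ℚ.⊓ δ₅)))
        δ≤₃₄₅ = ℚ.≤-trans (ℚ.p⊓q≤q δ₁ _) (ℚ.p⊓q≤q δ₂ (δ₃ ℚ.⊓ (δ₄ ℚ.⊓ δ₅)))
        δ≤₃ = ℚ.≤-trans δ≤₃₄₅ (ℚ.p⊓q≤p δ₃ (δ₄ ℚ.⊓ δ₅))
        δ≤₄₅ = ℚ.≤-trans δ≤₃₄₅ (ℚ.p⊓q≤q δ₃ (δ₄ ℚ.⊓ δ₅))
        δ≤₄ = ℚ.≤-trans δ≤₄₅ (ℚ.p⊓q≤p δ₄ δ₅)
        δ≤₅ = ℚ.≤-trans δ≤₄₅ (ℚ.p⊓q≤q δ₄ δ₅)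
    in δ
     , ⊓-pos δ₁ _ 0<δ₁ (⊓-pos δ₂ _ 0<δ₂ (⊓-pos δ₃ _ 0<δ₃ (⊓-pos δ₄ δ₅ 0<δ₄ 0<δ₅)))
     , λ y near → dominated-mono
         (ℚ.≤-reflexive (total ε A B K L))
         (dominated-cong
           (g ⟨ x ⟩ * remainder f d x y + f ⟨ x ⟩ * remainder g e x y + increment g x y * increment f x y)
           (remainder (f *ᶠ g) (d * g ⟨ x ⟩ + f ⟨ x ⟩ * e) x y)
           (seq-≡⇒≈
             {g ⟨ x ⟩ * remainder f d x y + f ⟨ x ⟩ * remainder g e x y + increment g x y * increment f x y}
             {remainder (f *ᶠ g) (d * g ⟨ x ⟩ + f ⟨ x ⟩ * e) x y}
             λ n → rearrange (seq (f ⟨ y ⟩) n) (seq (f ⟨ x ⟩) n) (seq (g ⟨ y ⟩) n) (seq (g ⟨ x ⟩) n)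
                     (seq d n) (seq e n) (seq (proj₁ y) n ℚ.- seq (proj₁ x) n))
           (dominated-+
             (g ⟨ x ⟩ * remainder f d x y + f ⟨ x ⟩ * remainder g e x y) (increment g x y * increment f x y)
             (dominated-+ (g ⟨ x ⟩ * remainder f d x y) (f ⟨ x ⟩ * remainder g e x y)
               (dominated-* (g ⟨ x ⟩) (remainder f d x y) g≤B (r y (near-mono x y δ≤₃ near)))
               (dominated-* (f ⟨ x ⟩) (remainder g e x y) f≤A (s y (near-mono x y δ≤₄ near))))
             (dominated-* (increment g x y) (increment f x y)
               (dominated⇒bounded 0<δ₅ (q y (near-mono x y δ≤₂ near)) (near-mono x y δ≤₅ near))
               (p y (near-mono x y (ℚ.p⊓q≤p δ₁ _) near)))))
    where
    open +-*-Solver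
    rearrange : ∀ fy fx gy gx d e h →
                gx ℚ.* ((fy ℚ.- fx) ℚ.- d ℚ.* h) ℚ.+ fx ℚ.* ((gy ℚ.- gx) ℚ.- e ℚ.* h)
                  ℚ.+ (gy ℚ.- gx) ℚ.* (fy ℚ.- fx)
                ≡ (fy ℚ.* gy ℚ.- fx ℚ.* gx) ℚ.- (d ℚ.* gx ℚ.+ fx ℚ.* e) ℚ.* h
    rearrange = solve 7 (λ fy fx gy gx d e h →
      gx :* ((fy :- fx) :- d :* h) :+ fx :* ((gy :- gx) :- e :* h) :+ (gy :- gx) :* (fy :- fx)
        := (fy :* gy :- fx :* gx) :- (d :* gx :+ fx :* e) :* h) ≡.refl

    total : ∀ ε A B K L .{{_ : ℚ.Positive A}} .{{_ : ℚ.Positive B}}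
            .{{_ : ℚ.Positive ((L ℚ.+ 1ℚ) ℚ.* K)}} →
            B ℚ.* ((½ ℚ.* (½ ℚ.* ε)) ÷⁺ B) ℚ.+ A ℚ.* ((½ ℚ.* (½ ℚ.* ε)) ÷⁺ A)
              ℚ.+ (L ℚ.+ 1ℚ) ℚ.* ((½ ℚ.* ε) ÷⁺ ((L ℚ.+ 1ℚ) ℚ.* K)) ℚ.* K ≡ ε
    total ε A B K L = ≡.trans
      (≡.cong₂ ℚ._+_
        (≡.trans (≡.cong₂ ℚ._+_ (*-÷⁺ (½ ℚ.* (½ ℚ.* ε)) B) (*-÷⁺ (½ ℚ.* (½ ℚ.* ε)) A)) (half+half (½ ℚ.* ε)))
        (≡.trans (solve 3 (λ L K t → L :* t :* K := L :* K :* t) ≡.refl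
                   (L ℚ.+ 1ℚ) K ((½ ℚ.* ε) ÷⁺ ((L ℚ.+ 1ℚ) ℚ.* K)))
                 (*-÷⁺ (½ ℚ.* ε) ((L ℚ.+ 1ℚ) ℚ.* K))))
      (half+half ε)

  -- The nonzero displacement for uniqueness of derivatives. Since η is rational, |y - x| equals η
  -- at every index and can be cancelled in ℚ.
  shift : ∀ (x : Point I) δ → 0ℚ ℚ.< δ →
          ∃[ η ] 0ℚ ℚ.< η × η ℚ.≤ δ × (proj₁ x + fromℚ η) ∈ I
  shift (x , x>a , x<b) δ 0<δ =
    let η , 0<η , η≤δ , x+η<b = below-shift x (OpenInterval.upper I) δ x<b 0<δ
    in η , 0<η , η≤δ , above-shift x (OpenInterval.lower I) η x>a 0<η , x+η<b

  -- Evaluated at x + η, the difference of the two remainders is (d - e) η.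
  hasDerivAt-unique : ∀ (f : I →ℝ) d e x → HasDerivAt f d x → HasDerivAt f e x → d ≈ e
  hasDerivAt-unique f d e x f′ f″ ε 0<ε =
    let τ   = ½ ℚ.* (½ ℚ.* (½ ℚ.* ε))
        0<τ = half-pos (half-pos (half-pos 0<ε))
        δ₁ , 0<δ₁ , p = toRational f d x f′ τ 0<τ
        δ₂ , 0<δ₂ , q = toRational f e x f″ τ 0<τ
        η , 0<η , η≤δ , x+η∈I = shift x (δ₁ ℚ.⊓ δ₂) (⊓-pos δ₁ δ₂ 0<δ₁ 0<δ₂)
        y = proj₁ x + fromℚ η , x+η∈I
        instance _ = ℚ.positive 0<η
        ∣h∣≡η = λ n → ≡.trans (≡.cong ℚ.∣_∣ (cancel (seq (proj₁ x) n) η)) (ℚ.0≤p⇒∣p∣≡p (ℚ.<⇒≤ 0<η))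
        near = 0 , λ n _ → ℚ.≤-trans (ℚ.≤-reflexive (∣h∣≡η n)) η≤δ
        instance _ = ℚ.positive 0<τ
        0<τη = ℚ.positive⁻¹ (τ ℚ.* η) {{ℚ.pos*pos⇒pos τ η}}
    in eventually-zip
      (λ n r≤ s≤ → ℚ.≤-<-trans
        (ℚ.*-cancelʳ-≤-pos η (bound (seq d n) (seq e n) (seq (f ⟨ y ⟩) n ℚ.- seq (f ⟨ x ⟩) n)
           (∣h∣≡η n) r≤ s≤))
        (half< 0<ε))
      (Dominated.bound (p y (near-mono x y (ℚ.p⊓q≤p δ₁ δ₂) near)) (τ ℚ.* η) 0<τη)
      (Dominated.bound (q y (near-mono x y (ℚ.p⊓q≤q δ₁ δ₂) near)) (τ ℚ.* η) 0<τη)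
    where
    open +-*-Solver
    open ℚ.≤-Reasoning

    half< : ∀ {ε} → 0ℚ ℚ.< ε → ½ ℚ.* ε ℚ.< ε
    half< {ε} 0<ε = begin-strict
      ½ ℚ.* ε                   ≡⟨ ℚ.+-identityʳ _ ⟨
      ½ ℚ.* ε ℚ.+ 0ℚ            <⟨ ℚ.+-monoʳ-< (½ ℚ.* ε) (half-pos 0<ε) ⟩
      ½ ℚ.* ε ℚ.+ ½ ℚ.* ε       ≡⟨ half+half ε ⟩
      ε                         ∎

    cancel : ∀ a b → (a ℚ.+ b) ℚ.- a ≡ b
    cancel = solve 2 (λ a b → (a :+ b) :- a := b) ≡.refl

    -- Each remainder contributes τη as its estimate and τη as slack. The four copies with τ = ε/8
    -- add up to (ε/2) η, strictly below ε η.
    bound : ∀ {h η} d e Δ → ℚ.∣ h ∣ ≡ η → let τ = ½ ℚ.* (½ ℚ.* (½ ℚ.* ε)) in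
            ℚ.∣ Δ ℚ.- d ℚ.* h ∣ ℚ.≤ τ ℚ.* ℚ.∣ h ∣ ℚ.+ τ ℚ.* η →
            ℚ.∣ Δ ℚ.- e ℚ.* h ∣ ℚ.≤ τ ℚ.* ℚ.∣ h ∣ ℚ.+ τ ℚ.* η →
            ℚ.∣ d ℚ.- e ∣ ℚ.* η ℚ.≤ (½ ℚ.* ε) ℚ.* η
    bound {h} d e Δ ≡.refl r≤ s≤ = begin
      ℚ.∣ d ℚ.- e ∣ ℚ.* ℚ.∣ h ∣
        ≡⟨ ℚ.∣p*q∣≡∣p∣*∣q∣ (d ℚ.- e) h ⟨
      ℚ.∣ (d ℚ.- e) ℚ.* h ∣
        ≡⟨ ≡.cong ℚ.∣_∣ (solve 4 (λ d e h Δ → (d :- e) :* h := (Δ :- e :* h) :- (Δ :- d :* h)) ≡.refl d e h Δ) ⟩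
      ℚ.∣ (Δ ℚ.- e ℚ.* h) ℚ.- (Δ ℚ.- d ℚ.* h) ∣
        ≤⟨ ℚ.∣p-q∣≤∣p∣+∣q∣ (Δ ℚ.- e ℚ.* h) (Δ ℚ.- d ℚ.* h) ⟩
      ℚ.∣ Δ ℚ.- e ℚ.* h ∣ ℚ.+ ℚ.∣ Δ ℚ.- d ℚ.* h ∣
        ≤⟨ ℚ.+-mono-≤ s≤ r≤ ⟩
      (τ ℚ.* ℚ.∣ h ∣ ℚ.+ τ ℚ.* ℚ.∣ h ∣) ℚ.+ (τ ℚ.* ℚ.∣ h ∣ ℚ.+ τ ℚ.* ℚ.∣ h ∣)
        ≡⟨ solve 2 (λ τ h → (τ :* h :+ τ :* h) :+ (τ :* h :+ τ :* h) := ((τ :+ τ) :+ (τ :+ τ)) :* h) ≡.refl τ ℚ.∣ h ∣ ⟩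
      ((τ ℚ.+ τ) ℚ.+ (τ ℚ.+ τ)) ℚ.* ℚ.∣ h ∣
        ≡⟨ ≡.cong (ℚ._* ℚ.∣ h ∣) (≡.trans (≡.cong₂ ℚ._+_ (half+half (½ ℚ.* (½ ℚ.* ε))) (half+half (½ ℚ.* (½ ℚ.* ε)))) (half+half (½ ℚ.* ε))) ⟩
      (½ ℚ.* ε) ℚ.* ℚ.∣ h ∣ ∎
      where τ = ½ ℚ.* (½ ℚ.* (½ ℚ.* ε))

  -- Agreement of the n-th derivatives on all of I lets the (n+1)-st derivative from `s` be read as
  -- a derivative of `deriv t n`, where uniqueness applies.
  deriv-unique : ∀ {f : I →ℝ} (s t : Smooth f) n x → deriv s n ⟨ x ⟩ ≈ deriv t n ⟨ x ⟩
  deriv-unique {f} s t zero    x = ≈-trans {deriv s 0 ⟨ x ⟩} {f ⟨ x ⟩} {deriv t 0 ⟨ x ⟩}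
    (deriv-zero s x) (≈-sym {deriv t 0 ⟨ x ⟩} {f ⟨ x ⟩} (deriv-zero t x))
  deriv-unique s t (suc n) x = hasDerivAt-unique (deriv t n) (deriv s (suc n) ⟨ x ⟩) (deriv t (suc n) ⟨ x ⟩) x
    (hasDerivAt-cong (deriv s n) (deriv t n) (deriv s (suc n) ⟨ x ⟩) x (deriv-unique s t n) (deriv-suc s n x))
    (deriv-suc t n x)

  leibnizᶠ : ℕ → (ℕ → I →ℝ) → (ℕ → I →ℝ) → I →ℝ
  leibnizᶠ zero    F G = F 0 *ᶠ G 0
  leibnizᶠ (suc n) F G = leibnizᶠ n (F ∘ suc) G +ᶠ leibnizᶠ n F (G ∘ suc)

  -- Only the base case is the product rule. Differentiating the two summands for `suc n` gives, by
  -- induction with F and G varying, exactly the two summands of the next step.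
  leibnizᶠ-hasDerivAt : ∀ n F G x →
    (∀ i → HasDerivAt (F i) (F (suc i) ⟨ x ⟩) x) →
    (∀ i → HasDerivAt (G i) (G (suc i) ⟨ x ⟩) x) →
    HasDerivAt (leibnizᶠ n F G) (leibnizᶠ (suc n) F G ⟨ x ⟩) x
  leibnizᶠ-hasDerivAt zero    F G x F′ G′ =
    hasDerivAt-* (F 0) (G 0) (F 1 ⟨ x ⟩) (G 1 ⟨ x ⟩) x (F′ 0) (G′ 0)
  leibnizᶠ-hasDerivAt (suc n) F G x F′ G′ =
    hasDerivAt-+ (leibnizᶠ n (F ∘ suc) G) (leibnizᶠ n F (G ∘ suc))
      (leibnizᶠ (suc n) (F ∘ suc) G ⟨ x ⟩) (leibnizᶠ (suc n) F (G ∘ suc) ⟨ x ⟩) x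
      (leibnizᶠ-hasDerivAt n (F ∘ suc) G x (F′ ∘ suc) G′)
      (leibnizᶠ-hasDerivAt n F (G ∘ suc) x F′ (G′ ∘ suc))

  smooth-* : ∀ {f g : I →ℝ} → Smooth f → Smooth g → Smooth (f *ᶠ g)
  smooth-* {f} {g} f∞ g∞ = record
    { deriv      = λ n → leibnizᶠ n (deriv f∞) (deriv g∞)
    ; deriv-zero = λ x → *-cong {deriv f∞ 0 ⟨ x ⟩} {f ⟨ x ⟩} {deriv g∞ 0 ⟨ x ⟩} {g ⟨ x ⟩}
        (deriv-zero f∞ x) (deriv-zero g∞ x)
    ; deriv-suc  = λ n x → leibnizᶠ-hasDerivAt n (deriv f∞) (deriv g∞) x
        (λ i → deriv-suc f∞ i x) (λ i → deriv-suc g∞ i x)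
    }

-- Taylor series and compositae

module ℝ⟦z⟧ = PowerSeries ℝ-commutativeRing
open ℝ⟦z⟧ using (module 𝕊)

1/_! : ℕ → ℝ
1/ n ! = fromℚ (ℚ._/_ (+ 1) (n !) {{n ℕ.!≢0}})

module ℝ-egf = ℝ⟦z⟧.Exponential 1/_! (λ n → ·-fromℚ-1/ (n !) {{n ℕ.!≢0}})

module ℝ-transfer = ℝ⟦z⟧.Transfer
  {_*_} (λ a b → ≈-refl {a * b})
  {∑≤} (λ n t → ≈-refl {∑≤ n t})

open RawMonoidDefs (RawSemiring.*-rawMonoid series-rawSemiring) using () renaming (_×_ to _×ˢ_)

-- k ×ˢ u is what u ^ˢ k unfolds to.
^ˢ≋^ : ∀ u k n → (u ^ˢ k) n ≈ (u 𝕊.^ k) n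
^ˢ≋^ u = ℝ-transfer.power-unique {u} (λ k → k ×ˢ u)
  (λ { zero → ≈-refl {1ℝ} ; (suc n) → ≈-refl {0ℝ} })
  (λ k n → ≈-refl {∑≤ n (λ i → u i * (k ×ˢ u) (n ∸ i))})

-- w ≈ ∑≤ k s unfolds to a statement about sequences, from which unification cannot
-- recover s; Holds does not unfold.
data Holds {A : Set} (P : A → Set) (a : A) : Set where
  holds : P a → Holds P a

holds⇒≈ : ∀ w k (c : ℕ → ℝ) a b →
  Holds (λ s → w ≈ ∑≤ k s) (λ j → (k C j) · (c j * a ^ (k ∸ j) * b ^ (k ∸ j))) →
  w ≈ ∑[ j ≤ k ] ((k C j) · (c j * a ^ (k ∸ j) * b ^ (k ∸ j)))
holds⇒≈ w k c a b (holds p) = p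

·-congʳ : ∀ m {x y} → x ≈ y → m · x ≈ m · y
·-congʳ zero    x≈y = ≈-refl {0ℝ}
·-congʳ (suc m) {x} {y} x≈y = +-cong {x} {y} {m · x} {m · y} x≈y (·-congʳ m {x} {y} x≈y)

-- Discharges the last hypothesis of `compositionSum-holds` for the summand of the theorem,
-- replacing one factor at a time.
·-*-cong : ∀ m e c a b x y q z → x ≈ a ^ e → y ≈ b ^ e → q ≈ c * x → z ≈ q * y →
           m · (c * a ^ e * b ^ e) ≈ m · z
·-*-cong m e c a b x y q z x≈ y≈ q≈ z≈ = ·-congʳ m {_} {z}
  (≈-sym {z} {c * a ^ e * b ^ e} (≈-trans {z} {q * y} {c * a ^ e * b ^ e} z≈
    (*-cong {q} {c * a ^ e} {y} {b ^ e}
      (≈-trans {q} {c * x} {c * a ^ e} q≈ (*-cong {c} {c} {x} {a ^ e} (≈-refl {c}) x≈)) y≈)))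

compositionSum-holds : ∀ {t u v : Series} {a b : ℝ} {n k : ℕ} {w : ℝ} (U V : ℕ → Series) {s : ℕ → ℝ} →
  w ≈ ℝ⟦z⟧.compositionSum t n k → b ≈ - 1ℝ →
  (∀ i → t i ≈ (u ℝ⟦z⟧.⊛ v) i) → t 0 ≈ a →
  (∀ j i → U j i ≈ (u 𝕊.^ j) i) → (∀ j i → V j i ≈ (v 𝕊.^ j) i) →
  (∀ j x y q z → x ≈ a ^ (k ∸ j) → y ≈ b ^ (k ∸ j) →
    q ≈ (∑[ i ≤ n ] (U j i * V j (n ∸ i))) * x → z ≈ q * y → s j ≈ (k C j) · z) →
  Holds (λ s → w ≈ ∑≤ k s) s
compositionSum-holds {t} {u} {v} {a} {b} {n} {k} {w} U V {s} w≈ b≈ t≈ t₀≈ U≈ V≈ s≈ =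
  holds (ℝ-transfer.compositionSum-∑ {t} {u} {v} {a} {b} {n} {k} {w} U V s w≈ b≈ t≈ t₀≈ U≈ V≈ s≈)

compositionSum-binomial : ∀ {t u v : Series} {a b : ℝ} {n k : ℕ} {w : ℝ} (U V : ℕ → Series) →
  w ≈ ℝ⟦z⟧.compositionSum t n k → b ≈ - 1ℝ →
  (∀ i → t i ≈ (u ℝ⟦z⟧.⊛ v) i) → t 0 ≈ a →
  (∀ j i → U j i ≈ (u 𝕊.^ j) i) → (∀ j i → V j i ≈ (v 𝕊.^ j) i) →
  w ≈ ∑[ j ≤ k ] ((k C j) · ((∑[ i ≤ n ] (U j i * V j (n ∸ i))) * a ^ (k ∸ j) * b ^ (k ∸ j)))
compositionSum-binomial {t} {u} {v} {a} {b} {n} {k} {w} U V w≈ b≈ t≈ t₀≈ U≈ V≈ =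
  holds⇒≈ w k (λ j → ∑≤ n (λ i → U j i * V j (n ∸ i))) a b
    (compositionSum-holds {t} {u} {v} {a} {b} {n} {k} {w} U V w≈ b≈ t≈ t₀≈ U≈ V≈
      (λ j → ·-*-cong (k C j) (k ∸ j) (∑≤ n (λ i → U j i * V j (n ∸ i))) a b))

module _ {I : OpenInterval} where

  leibnizᶠ≈leibniz : ∀ n (F G : ℕ → I →ℝ) x →
    leibnizᶠ n F G ⟨ x ⟩ ≈ ℝ⟦z⟧.leibniz n (λ i → F i ⟨ x ⟩) (λ i → G i ⟨ x ⟩)
  leibnizᶠ≈leibniz zero    F G x = ≈-refl {F 0 ⟨ x ⟩ * G 0 ⟨ x ⟩}
  leibnizᶠ≈leibniz (suc n) F G x = +-cong
    {leibnizᶠ n (F ∘ suc) G ⟨ x ⟩} {ℝ⟦z⟧.leibniz n (λ i → F (suc i) ⟨ x ⟩) (λ i → G i ⟨ x ⟩)}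
    {leibnizᶠ n F (G ∘ suc) ⟨ x ⟩} {ℝ⟦z⟧.leibniz n (λ i → F i ⟨ x ⟩) (λ i → G (suc i) ⟨ x ⟩)}
    (leibnizᶠ≈leibniz n (F ∘ suc) G x) (leibnizᶠ≈leibniz n F (G ∘ suc) x)

  deriv-* : ∀ {f g} (f∞ : Smooth {I} f) (g∞ : Smooth {I} g) (a∞ : Smooth (_*ᶠ_ {I} f g)) (x : Point I) n →
    deriv a∞ n ⟨ x ⟩ ≈ ℝ⟦z⟧.leibniz n (λ i → deriv f∞ i ⟨ x ⟩) (λ i → deriv g∞ i ⟨ x ⟩)
  deriv-* {f} {g} f∞ g∞ a∞ x n = ≈-trans
    {deriv a∞ n ⟨ x ⟩} {leibnizᶠ n (deriv f∞) (deriv g∞) ⟨ x ⟩}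
    {ℝ⟦z⟧.leibniz n (λ i → deriv f∞ i ⟨ x ⟩) (λ i → deriv g∞ i ⟨ x ⟩)}
    (deriv-unique {I} {_*ᶠ_ {I} f g} a∞ (smooth-* {I} {f} {g} f∞ g∞) n x)
    (leibnizᶠ≈leibniz n (deriv f∞) (deriv g∞) x)

  taylor-* : ∀ {f g} (f∞ : Smooth {I} f) (g∞ : Smooth {I} g) (a∞ : Smooth (_*ᶠ_ {I} f g)) (x : Point I) n →
             taylor a∞ x n ≈ (taylor f∞ x ℝ⟦z⟧.⊛ taylor g∞ x) n
  taylor-* {f} {g} f∞ g∞ a∞ x = ℝ-egf.egf-product {taylor a∞ x} {taylor f∞ x} {taylor g∞ x}
    (λ i → deriv f∞ i ⟨ x ⟩) (λ i → deriv g∞ i ⟨ x ⟩)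
    (λ i → ≈-refl {taylor f∞ x i}) (λ i → ≈-refl {taylor g∞ x i})
    (λ n → *-cong {deriv a∞ n ⟨ x ⟩} {ℝ⟦z⟧.leibniz n (λ i → deriv f∞ i ⟨ x ⟩) (λ i → deriv g∞ i ⟨ x ⟩)}
                  {1/ n !} {1/ n !} (deriv-* {f} {g} f∞ g∞ a∞ x n) (≈-refl {1/ n !}))

  taylor-zero : ∀ {h : I →ℝ} (h∞ : Smooth h) x → taylor h∞ x 0 ≈ h ⟨ x ⟩
  taylor-zero {h} h∞ x = ≈-trans {taylor h∞ x 0} {h ⟨ x ⟩ * 1ℝ} {h ⟨ x ⟩}
    -- The factor 1/0! computes to 1.
    (*-cong {deriv h∞ 0 ⟨ x ⟩} {h ⟨ x ⟩} {1ℝ} {1ℝ} (deriv-zero h∞ x) (≈-refl {1ℝ}))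
    (seq-≡⇒≈ {h ⟨ x ⟩ * 1ℝ} {h ⟨ x ⟩} λ n → ℚ.*-identityʳ (seq (h ⟨ x ⟩) n))

theorem3p4 : (I : OpenInterval) (f g : I →ℝ) (f∞ : Smooth f) (g∞ : Smooth g) →
    Smooth (f *ᶠ g) ×
    ((a∞ : Smooth (f *ᶠ g)) (n k : ℕ) → 1 ℕ.≤ k → k ℕ.≤ n → (x : Point I) →
    composita a∞ n k x ≈
    ∑[ j ≤ k ] ((k C j) ·
    ((∑[ i ≤ n ] (powerCoeff f∞ i j x * powerCoeff g∞ (n ∸ i) j x))
    * (f ⟨ x ⟩ * g ⟨ x ⟩) ^ (k ∸ j)
    * (- 1ℝ) ^ (k ∸ j))))
-- The implicit intervals in the statement are the η-expansion of I; matching on I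
-- identifies them with I.
theorem3p4 I@(⟨ _ , _ ⟩) f g f∞ g∞ = smooth-* {I} {f} {g} f∞ g∞ , λ a∞ n k _ _ x →
  compositionSum-binomial
    {taylor a∞ x} {taylor f∞ x} {taylor g∞ x} {f ⟨ x ⟩ * g ⟨ x ⟩} { - 1ℝ} {n} {k} {composita a∞ n k x}
    (λ j i → powerCoeff f∞ i j x) (λ j i → powerCoeff g∞ i j x)
    (≈-refl {composita a∞ n k x}) (≈-refl { - 1ℝ})
    (taylor-* {I} {f} {g} f∞ g∞ a∞ x) (taylor-zero {I} {_*ᶠ_ {I} f g} a∞ x)
    (^ˢ≋^ (taylor f∞ x)) (^ˢ≋^ (taylor g∞ x))
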